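{- Let $G$ be a graph (loops and multiple edges allowed) with maximum degree $4$. Then $G$ has a strong edge-coloring with at most $22$ colors.
   Context: A strong edge-coloring is an assignment of colors to the edges such that any two distinct edges that share an endpoint, or that lie on a common path of length three (equivalently, some edge joins an endpoint of one to an endpoint of the other), receive different colors. Throughout the paper graphs may contain loops and multiple edges. -}

module Defs where

open import Data.Nat using (ℕ; zero; suc; _+_; _≤_)
open import Data.Fin using (Fin; _≟_)
open import Data.List using (List; map; allFin)
open import Data.Nat.ListAction using (sum)
open import Data.Product using (_×_; Σ; ∃; _,_; proj₁; proj₂)
open import Data.Sum using (_⊎_)
open import Relation.Nullary using (¬_; does)
open import Data.Bool using (if_then_else_)
open import Relation.Binary.PropositionalEquality using (_≡_)

-- A finite multigraph with loops: vertex set Fin n, edge set Fin m,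
-- each edge has an (unordered) pair of endpoints, given as an ordered pair;
-- an edge whose two endpoints coincide is a loop.
record Graph : Set where
  field
    n   : ℕ
    m   : ℕ
    ends : Fin m → Fin n × Fin n

open Graph public

IsEnd : (G : Graph) → Fin (m G) → Fin (n G) → Set
IsEnd G e x = (proj₁ (ends G e) ≡ x) ⊎ (proj₂ (ends G e) ≡ x)

δ : ∀ {k} → Fin k → Fin k → ℕ
δ x y = if does (x ≟ y) then 1 else 0

-- degree of v: number of edge-ends at v (a loop contributes 2)
degree : (G : Graph) → Fin (n G) → ℕ
degree G v = sum (map (λ e → δ (proj₁ (ends G e)) v + δ (proj₂ (ends G e)) v) (allFin (m G)))

MaxDegree : Graph → ℕ → Set
MaxDegree G d = (∀ v → degree G v ≤ d) × (∃ λ v → degree G v ≡ d)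

Conflict : (G : Graph) → Fin (m G) → Fin (m G) → Set
Conflict G e f =
  (∃ λ x → IsEnd G e x × IsEnd G f x)
  ⊎ (∃ λ g → ∃ λ x → ∃ λ y →
       IsEnd G e x × IsEnd G f y
       × (((proj₁ (ends G g) ≡ x) × (proj₂ (ends G g) ≡ y))
          ⊎ ((proj₁ (ends G g) ≡ y) × (proj₂ (ends G g) ≡ x))))

IsStrongEdgeColoring : (G : Graph) (k : ℕ) → (Fin (m G) → Fin k) → Set
IsStrongEdgeColoring G k c =
  ∀ e f → ¬ (e ≡ f) → Conflict G e f → ¬ (c e ≡ c f)

-- Grow a set of vertices from a vertex v along edges and color the edges that avoid it, shrinking the
-- set back to v. An edge at a vertex about to leave the set sees at most 24 edges, counted with
-- repetition, four of them at a neighbor that stays in the set; these four are uncolored except for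
-- at most one precolored edge, provided that the precolored edges form a matching, so 22 colors
-- suffice. It remains to choose v and the precoloring so that the edges at v can be finished as well,
-- which takes repetitions among the 24 edges seen by them. The choice is made in this order:
--   * v of degree at most 3, with a loop, or with parallel edges: no precoloring;
--   * v in a triangle: no precoloring;
--   * v and u with three common neighbors a, b, c: an edge aa₁ and an edge bb₁ precolored alike, unless
--     two of a, b, c have a third common neighbor; if all such pairs conflicted, a₁ would have degree 5;
--   * v in a 4-cycle: two pairs of pendant edges at opposite vertices of the cycle, each pair
--     precolored alike;
--   * girth at least 5: one edge vᵢwᵢ at each of the four neighbors vᵢ of v, all precolored alike; pairwise
--     nonadjacent wᵢ exist because there are no triangles and no 4-cycles.
module Submission where

open import Defs
open import Data.Bool using (if_then_else_)
open import Data.Empty using (⊥; ⊥-elim)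
open import Data.Fin using (Fin; zero; suc; _≟_)
open import Data.Fin.Properties using (any?; ¬∀⟶∃¬)
open import Data.List using (List; []; _∷_; _++_; length; map; mapMaybe; filter; concatMap; allFin)
open import Data.List.Membership.Propositional using (_∈_; _∉_)
open import Data.List.Membership.DecPropositional using (_∈?_)
open import Data.List.Membership.Propositional.Properties
  using (∈-allFin; ∈-filter⁺; ∈-filter⁻; ∈-++⁺ˡ; ∈-++⁺ʳ; ∈-++⁻; ∈-concatMap⁺; ∈-map⁺; ∈-map⁻)
open import Data.List.Properties using (length-++; length-tabulate; length-mapMaybe)
open import Data.List.Relation.Unary.All using (All; []; _∷_)
import Data.List.Relation.Unary.All as All
open import Data.List.Relation.Unary.AllPairs using (AllPairs; []; _∷_)
import Data.List.Relation.Unary.AllPairs as AllPairs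
import Data.List.Relation.Unary.AllPairs.Properties as AllPairs
open import Data.List.Relation.Unary.Any using (Any; here; there)
import Data.List.Relation.Unary.Any as Any
open import Data.List.Relation.Unary.Unique.Propositional using (Unique)
import Data.List.Relation.Unary.Unique.Propositional.Properties as Unique
open import Data.Maybe using (Maybe; just; nothing; _<∣>_)
open import Data.Nat using (ℕ; zero; suc; _+_; _*_; _≤_; _<_; z≤n; s≤s)
open import Data.Nat.ListAction using (sum)
open import Data.Nat.Properties
  using (≤-refl; ≤-reflexive; ≤-trans; ≤-pred; +-mono-≤; m≤m+n; m≤n+m; n≤1+n; +-suc; +-identityʳ; <⇒≱)
import Data.Nat as ℕ
open import Data.Product using (Σ; ∃; ∃-syntax; _×_; _,_; proj₁; proj₂)
open import Data.Sum using (_⊎_; inj₁; inj₂; [_,_]′; swap)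
open import Data.Unit using (⊤; tt)
open import Function using (_∘_; id)
open import Level using (Level)
open import Relation.Nullary using (¬_; Dec; yes; no; does; contradiction)
open import Relation.Nullary.Decidable using (True; toWitness; _×-dec_; _⊎-dec_; ¬?; dec-true; dec-false)
open import Relation.Unary using (Decidable)
open import Relation.Binary.PropositionalEquality using (_≡_; _≢_; refl; sym; trans; cong; subst)

-- Lists, the pigeonhole principle and finite search

private
  variable
    a : Level
    A : Set a

remove : ∀ {x : A} {ys} → x ∈ ys → ∃[ zs ] length ys ≡ suc (length zs) × (∀ {y} → y ∈ ys → y ≢ x → y ∈ zs)
remove {ys = _ ∷ zs} (here refl) = zs , refl , λ { (here refl) y≢x → contradiction refl y≢x ; (there p) _ → p }
remove {ys = y ∷ _} (there p) with remove p
... | zs , eq , keep = y ∷ zs , cong suc eq , λ { (here refl) _ → here refl ; (there q) y≢x → there (keep q y≢x) }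

-- Induction on `xs`: the head is deleted from `ys`, and the tail, which avoids it, stays within
-- what is left.
unique-⊆⇒length≤ : ∀ {xs ys : List A} → Unique xs → (∀ {x} → x ∈ xs → x ∈ ys) → length xs ≤ length ys
unique-⊆⇒length≤ [] _ = z≤n
unique-⊆⇒length≤ {xs = x ∷ xs} (x∉ ∷ u) sub with remove (sub (here refl))
... | zs , eq , keep = subst (suc (length xs) ≤_) (sym eq)
  (s≤s (unique-⊆⇒length≤ u λ p → keep (sub (there p)) λ q → All.lookup x∉ p (sym q)))

length≤0 : ∀ {xs : List A} → length xs ≤ 0 → ∀ {x} → x ∉ xs
length≤0 {xs = []} _ ()
length≤0 {xs = _ ∷ _} ()

abstract
  fresh : ∀ {k} (xs : List (Fin k)) → length xs < k → ∃[ i ] i ∉ xs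
  fresh {k} xs short = ¬∀⟶∃¬ k (_∈ xs) (λ i → Any.any? (i ≟_) xs)
    λ all → <⇒≱ short (subst (_≤ length xs) (length-tabulate {n = k} id)
      (unique-⊆⇒length≤ (Unique.allFin⁺ k) λ {i} _ → all i))

lookupPairs : ∀ {R : A → A → Set} {xs x y} → (∀ {x y} → R x y → R y x) → AllPairs R xs → x ∈ xs → y ∈ xs → x ≡ y ⊎ R x y
lookupPairs s (_ ∷ _) (here refl) (here refl) = inj₁ refl
lookupPairs s (r ∷ _) (here refl) (there q) = inj₂ (All.lookup r q)
lookupPairs s (r ∷ _) (there p) (here refl) = inj₂ (s (All.lookup r p))
lookupPairs s (_ ∷ rs) (there p) (there q) = lookupPairs s rs p q

-- `P` and `Q` need not be complementary, so each outcome carries the evidence that is wanted later.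
search : ∀ {k} {P Q : Fin k → Set} → (∀ i → P i ⊎ Q i) → ∃ P ⊎ (∀ i → Q i)
search {zero} _ = inj₂ λ ()
search {suc _} f with f zero | search (f ∘ suc)
... | inj₁ p | _ = inj₁ (zero , p)
... | inj₂ _ | inj₁ (i , p) = inj₁ (suc i , p)
... | inj₂ q | inj₂ r = inj₂ λ { zero → q ; (suc i) → r i }

decide : ∀ {P : Set} → Dec P → P ⊎ ¬ P
decide (yes p) = inj₁ p
decide (no ¬p) = inj₂ ¬p

filter-length≤sum : ∀ {P : A → Set} (P? : Decidable P) (w : A → ℕ) → (∀ x → P x → 1 ≤ w x) →
  ∀ xs → length (filter P? xs) ≤ sum (map w xs)
filter-length≤sum P? w le [] = z≤n
filter-length≤sum P? w le (x ∷ xs) with P? x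
... | yes p = +-mono-≤ (le x p) (filter-length≤sum P? w le xs)
... | no _ = ≤-trans (filter-length≤sum P? w le xs) (m≤n+m _ _)

-- The strict inequality serves loops: a loop is one entry of the filtered list but has weight two
-- in the degree.
filter-length<sum : ∀ {P : A → Set} (P? : Decidable P) (w : A → ℕ) → (∀ x → P x → 1 ≤ w x) →
  ∀ {xs y} → y ∈ xs → 2 ≤ w y → length (filter P? xs) < sum (map w xs)
filter-length<sum P? w le {x ∷ xs} (here refl) two with P? x
... | yes p = +-mono-≤ two (filter-length≤sum P? w le xs)
... | no _ = +-mono-≤ (≤-trans (s≤s z≤n) two) (filter-length≤sum P? w le xs)
filter-length<sum P? w le {x ∷ xs} (there q) two with P? x
... | yes p = ≤-trans (≤-reflexive (sym (+-suc 1 _))) (+-mono-≤ (le x p) (filter-length<sum P? w le q two))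
... | no _ = ≤-trans (filter-length<sum P? w le q two) (m≤n+m _ _)

Color : Set
Color = Fin 22

-- Joins, incidence lists and degrees

module _ (G : Graph) (degree≤4 : ∀ x → degree G x ≤ 4) where

  V E : Set
  V = Fin (n G)
  E = Fin (m G)

  -- This is literally the last disjunction of `Conflict`, so a joining edge passes to and from
  -- conflicts without conversion.
  Join : E → V → V → Set
  Join g x y = ((proj₁ (ends G g) ≡ x) × (proj₂ (ends G g) ≡ y))
             ⊎ ((proj₁ (ends G g) ≡ y) × (proj₂ (ends G g) ≡ x))

  join-sym : ∀ {g x y} → Join g x y → Join g y x
  join-sym = swap

  join? : ∀ g x y → Dec (Join g x y)
  join? g x y = ((_ ≟ x) ×-dec (_ ≟ y)) ⊎-dec ((_ ≟ y) ×-dec (_ ≟ x))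

  end? : ∀ g x → Dec (IsEnd G g x)
  end? g x = (_ ≟ x) ⊎-dec (_ ≟ x)

  join-endˡ : ∀ {g x y} → Join g x y → IsEnd G g x
  join-endˡ (inj₁ (p , _)) = inj₁ p
  join-endˡ (inj₂ (_ , p)) = inj₂ p

  join-endʳ : ∀ {g x y} → Join g x y → IsEnd G g y
  join-endʳ = join-endˡ ∘ join-sym

  end-join : ∀ {g x} → IsEnd G g x → ∃[ y ] Join g x y
  end-join (inj₁ p) = _ , inj₁ (p , refl)
  end-join (inj₂ p) = _ , inj₂ (refl , p)

  join-end : ∀ {g x y z} → Join g x y → IsEnd G g z → x ≡ z ⊎ y ≡ z
  join-end (inj₁ (refl , refl)) e = e
  join-end (inj₂ (refl , refl)) e = swap e

  join-unique : ∀ {g x y z} → Join g x y → Join g x z → y ≡ z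
  join-unique (inj₁ (refl , refl)) (inj₁ (_ , q)) = q
  join-unique (inj₁ (refl , refl)) (inj₂ (q , r)) = trans r q
  join-unique (inj₂ (refl , refl)) (inj₁ (q , r)) = trans q r
  join-unique (inj₂ (refl , refl)) (inj₂ (q , _)) = q

  conflict-sym : ∀ {e f} → Conflict G e f → Conflict G f e
  conflict-sym (inj₁ (x , p , q)) = inj₁ (x , q , p)
  conflict-sym (inj₂ (g , x , y , p , q , j)) = inj₂ (g , y , x , q , p , join-sym j)

  inc : V → List E
  inc x = filter (λ g → end? g x) (allFin (m G))

  ∈-inc : ∀ {g x} → IsEnd G g x → g ∈ inc x
  ∈-inc {g} {x} = ∈-filter⁺ (λ g → end? g x) (∈-allFin g)

  inc-∈ : ∀ {g x} → g ∈ inc x → IsEnd G g x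
  inc-∈ {x = x} = proj₂ ∘ ∈-filter⁻ (λ g → end? g x) {xs = allFin (m G)}

  inc-unique : ∀ x → Unique (inc x)
  inc-unique x = Unique.filter⁺ (λ g → end? g x) (Unique.allFin⁺ _)

  private
    δ-refl : ∀ {k} {x y : Fin k} → x ≡ y → 1 ≤ δ x y
    δ-refl {x = x} {y} p with x ≟ y
    ... | yes _ = s≤s z≤n
    ... | no ¬p = contradiction p ¬p

    end-weight : ∀ x g → IsEnd G g x → 1 ≤ δ (proj₁ (ends G g)) x + δ (proj₂ (ends G g)) x
    end-weight x g (inj₁ p) = ≤-trans (δ-refl p) (m≤m+n _ _)
    end-weight x g (inj₂ p) = ≤-trans (δ-refl p) (m≤n+m _ _)

  length-inc : ∀ x → length (inc x) ≤ 4
  length-inc x = ≤-trans (filter-length≤sum _ _ (end-weight x) (allFin (m G))) (degree≤4 x)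

  length-inc-loop : ∀ {g x} → Join g x x → length (inc x) ≤ 3
  length-inc-loop {g} {x} j =
    ≤-pred (≤-trans (filter-length<sum _ _ (end-weight x) (∈-allFin g) (two j)) (degree≤4 x))
    where
    two : Join g x x → 2 ≤ δ (proj₁ (ends G g)) x + δ (proj₂ (ends G g)) x
    two (inj₁ (p , q)) = +-mono-≤ (δ-refl p) (δ-refl q)
    two (inj₂ (p , q)) = +-mono-≤ (δ-refl p) (δ-refl q)

  length-distinct : ∀ {x hs} → Unique hs → (∀ {h} → h ∈ hs → IsEnd G h x) → length hs ≤ 4
  length-distinct {x} u at = ≤-trans (unique-⊆⇒length≤ u (∈-inc ∘ at)) (length-inc x)

  rest : V → List E → List E
  rest x hs = filter (λ g → ¬? (_∈?_ _≟_ g hs)) (inc x)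

  ∈-rest : ∀ {g x hs} → IsEnd G g x → g ∉ hs → g ∈ rest x hs
  ∈-rest {hs = hs} p q = ∈-filter⁺ (λ g → ¬? (_∈?_ _≟_ g hs)) (∈-inc p) q

  rest-∈ : ∀ {g x hs} → g ∈ rest x hs → IsEnd G g x × g ∉ hs
  rest-∈ {x = x} {hs} p with ∈-filter⁻ (λ g → ¬? (_∈?_ _≟_ g hs)) {xs = inc x} p
  ... | q , r = inc-∈ q , r

  -- `hs` and `rest x hs` are disjoint and together form a duplicate-free list of edges at `x`.
  length-rest : ∀ {x hs} → Unique hs → (∀ {h} → h ∈ hs → IsEnd G h x) → length hs + length (rest x hs) ≤ length (inc x)
  length-rest {x} {hs} u at = subst (_≤ length (inc x)) (length-++ hs)
    (unique-⊆⇒length≤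
      (Unique.++⁺ u (Unique.filter⁺ _ (inc-unique x)) λ (p , q) → proj₂ (rest-∈ {x = x} q) p)
      ([ ∈-inc ∘ at , proj₁ ∘ ∈-filter⁻ _ {xs = inc x} ]′ ∘ ∈-++⁻ hs))

  -- Partial colorings

  Partial : Set
  Partial = E → Maybe Color

  Valid : Partial → Set
  Valid c = ∀ {e f k} → e ≢ f → Conflict G e f → c e ≡ just k → c f ≢ just k

  Colored : Partial → E → Set
  Colored c e = ∃[ k ] c e ≡ just k

  colored? : ∀ c e → Colored c e ⊎ c e ≡ nothing
  colored? c e with c e
  ... | just k = inj₁ (k , refl)
  ... | nothing = inj₂ refl

  infix 4 _⊑_
  _⊑_ : Partial → Partial → Set
  c ⊑ d = ∀ {e k} → c e ≡ just k → d e ≡ just k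

  Free : Partial → E → Color → Set
  Free c e k = ∀ f → Conflict G e f → c f ≢ just k

  _[_≔_] : Partial → E → Color → Partial
  (c [ e ≔ k ]) f = if does (f ≟ e) then just k else c f

  update-same : ∀ c e k → (c [ e ≔ k ]) e ≡ just k
  update-same c e k with e ≟ e
  ... | yes _ = refl
  ... | no ¬p = contradiction refl ¬p

  update-other : ∀ c {e f k} → f ≢ e → (c [ e ≔ k ]) f ≡ c f
  update-other c {e} {f} f≢e with f ≟ e
  ... | yes p = contradiction p f≢e
  ... | no _ = refl

  update-valid : ∀ {c e k} → Valid c → Free c e k → Valid (c [ e ≔ k ])
  update-valid {c} {e} v free {f} {g} f≢g con p q with f ≟ e | g ≟ e
  ... | yes refl | yes refl = f≢g refl
  ... | yes refl | no _ with refl ← p = free g con q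
  ... | no _ | yes refl with refl ← q = free f (conflict-sym con) p
  ... | no _ | no _ = v f≢g con p q

  nothing≢just : ∀ {c : Partial} {e k} → c e ≡ nothing → c e ≢ just k
  nothing≢just p q with () ← trans (sym p) q

  update-⊑ : ∀ {c e k} → c e ≡ nothing → c ⊑ c [ e ≔ k ]
  update-⊑ {c} {e} un {f} p with f ≟ e
  ... | yes refl = contradiction p (nothing≢just {c} un)
  ... | no _ = p

  -- d ranges over the colorings that can arise from c by coloring some of the edges in pre.
  Order : Partial → List E → List E → Set
  Order c pre [] = ⊤
  Order c pre (e ∷ es) =
    (∀ d → c ⊑ d → (∀ {f} → f ∉ pre → d f ≡ c f) → d e ≡ nothing → ∃ (Free d e)) × Order c (e ∷ pre) es

  -- The greedy algorithm: `es` is processed from left to right, and an edge that already has a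
  -- color keeps it. The list `pre` records the processed edges, outside which the current coloring
  -- `d` still agrees with `c`.
  extend : ∀ {c d} pre es → Order c pre es → Valid d → c ⊑ d → (∀ {f} → f ∉ pre → d f ≡ c f) →
    ∃[ d′ ] Valid d′ × d ⊑ d′ × (∀ {f} → f ∉ pre → f ∉ es → d′ f ≡ c f) × (∀ {e} → e ∈ es → Colored d′ e)
  extend {d = d} pre [] _ v sub same = d , v , id , (λ p _ → same p) , λ ()
  extend {c} {d} pre (e ∷ es) (free , order) v sub same with colored? d e
  ... | inj₁ (k , eq) with d′ , v′ , sub′ , same′ , col ← extend (e ∷ pre) es order v sub (same ∘ (_∘ there)) =
    d′ , v′ , sub′ , (λ p q → same′ (λ { (here refl) → q (here refl) ; (there r) → p r }) (q ∘ there)) ,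
    λ { (here refl) → k , sub′ eq ; (there p) → col p }
  ... | inj₂ un with k , fr ← free d sub same un
    with d′ , v′ , sub′ , same′ , col ← extend {d = d [ e ≔ k ]} (e ∷ pre) es order (update-valid v fr)
      (update-⊑ {d} un ∘ sub) (λ p → trans (update-other d (λ q → p (here q))) (same (p ∘ there))) =
    d′ , v′ , sub′ ∘ update-⊑ {d} un ,
    (λ p q → same′ (λ { (here refl) → q (here refl) ; (there r) → p r }) (q ∘ there)) ,
    λ { (here refl) → k , sub′ (update-same d e k) ; (there p) → col p }

  -- Counting the colors seen by an edge

  -- `L` need not contain `f` itself, only some edge of the same color. This is what allows a
  -- repeated color to be counted once.
  Seen : Partial → List E → E → Set
  Seen c L f = ∀ {k} → c f ≡ just k → ∃[ g ] g ∈ L × c g ≡ just k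

  -- Except makes room for edges parallel to e: they may be ignored at one end of e, because the
  -- other end accounts for them.
  Side : Partial → List E → E → V → (E → Set) → Set
  Side c L e x Except = ∀ {g} → IsEnd G g x → g ≢ e → Except g ⊎ (∃[ z ] Join g x z × (∀ {f} → IsEnd G f z → Seen c L f))

  ∈-colors : ∀ (c : Partial) {L g k} → g ∈ L → c g ≡ just k → k ∈ mapMaybe c L
  ∈-colors c {g ∷ _} (here refl) eq with c g
  ∈-colors c {g ∷ _} (here refl) refl | just k = here refl
  ∈-colors c {h ∷ _} (there p) eq with c h
  ... | just _ = there (∈-colors c p eq)
  ... | nothing = ∈-colors c p eq

  abstract
    -- An edge that conflicts with `e` ends at `x`, at `y` or at a neighbor of one of them. Edges at
    -- `x` or `y` are also edges at the neighbor at their other end, so every forbidden color occurs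
    -- in `L`, and one of the 22 colors is left.
    free-color : ∀ {c e x y L} → Join e x y → c e ≡ nothing → length L ≤ 21 →
      Side c L e x (λ g → Join g x y) → Side c L e y (λ _ → ⊥) → ∃ (Free c e)
    free-color {c} {e} {x} {y} {L} j un len sx sy =
      let k , k∉ = fresh (mapMaybe c L) (s≤s (≤-trans (length-mapMaybe c L) len))
      in k , λ f con eq → let g , g∈ , eq′ = seen con eq in k∉ (∈-colors c g∈ eq′)
      where
      other : ∀ {f k} → c f ≡ just k → f ≢ e
      other eq refl = nothing≢just {c} un eq

      at-y : ∀ {f} → IsEnd G f y → Seen c L f
      at-y p eq with sy p (other eq)
      ... | inj₂ (z , jz , all) = all (join-endʳ jz) eq

      at-x : ∀ {f} → IsEnd G f x → Seen c L f
      at-x p eq with sx p (other eq)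
      ... | inj₁ j′ = at-y (join-endʳ j′) eq
      ... | inj₂ (z , jz , all) = all (join-endʳ jz) eq

      near-y : ∀ {g z f} → Join g y z → IsEnd G f z → Seen c L f
      near-y {g} {z} {f} jz p with g ≟ e
      ... | yes refl = at-x (subst (IsEnd G f) (join-unique jz (join-sym {g} j)) p)
      ... | no g≢e with sy (join-endˡ jz) g≢e
      ...   | inj₂ (_ , j′ , all) = all (subst (IsEnd G f) (join-unique jz j′) p)

      near-x : ∀ {g z f} → Join g x z → IsEnd G f z → Seen c L f
      near-x {g} {z} {f} jz p with g ≟ e
      ... | yes refl = at-y (subst (IsEnd G f) (join-unique jz j) p)
      ... | no g≢e with sx (join-endˡ jz) g≢e
      ...   | inj₁ j′ = at-y (subst (IsEnd G f) (join-unique jz j′) p)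
      ...   | inj₂ (_ , j′ , all) = all (subst (IsEnd G f) (join-unique jz j′) p)

      seen : ∀ {f} → Conflict G e f → Seen c L f
      seen (inj₁ (z , p , q)) with join-end j p
      ... | inj₁ refl = at-x q
      ... | inj₂ refl = at-y q
      seen (inj₂ (g , z , w , p , q , jg)) with join-end j p
      ... | inj₁ refl = near-x jg q
      ... | inj₂ refl = near-y jg q

  -- Edges around the neighbors of a vertex

  other : V → E → V
  other x g = if does (proj₁ (ends G g) ≟ x) then proj₂ (ends G g) else proj₁ (ends G g)

  join-other : ∀ {g x} → IsEnd G g x → Join g x (other x g)
  join-other {g} {x} p with proj₁ (ends G g) ≟ x
  ... | yes q = inj₁ (q , refl)
  join-other (inj₁ p) | no ¬q = contradiction p ¬q
  join-other (inj₂ p) | no ¬q = inj₂ (refl , p)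

  stars : V → List E → List E
  stars x = concatMap (inc ∘ other x)

  length-stars : ∀ x hs {k} → length hs ≤ k → length (stars x hs) ≤ k * 4
  length-stars x [] _ = z≤n
  length-stars x (h ∷ hs) (s≤s le) = subst (_≤ _) (sym (length-++ (inc (other x h))))
    (+-mono-≤ (length-inc (other x h)) (length-stars x hs le))

  side-stars : ∀ {c L e x hs Except} → (∀ {g} → g ∈ stars x hs → g ∈ L) →
    (∀ {g} → IsEnd G g x → g ≢ e → g ∉ hs → Except g ⊎ (∃[ z ] Join g x z × (∀ {f} → IsEnd G f z → Seen c L f))) →
    Side c L e x Except
  side-stars {x = x} {hs} sub leftover {g} p g≢e with _∈?_ _≟_ g hs
  ... | no g∉ = leftover p g≢e g∉
  ... | yes g∈ = inj₂ (other x g , join-other p , λ {f} q {k} eq →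
    f , sub (∈-concatMap⁺ (inc ∘ other x) (Any.map (λ { refl → ∈-inc q }) g∈)) , eq)

  length-rest₁ : ∀ {x e k} → IsEnd G e x → length (inc x) ≤ suc k → length (rest x (e ∷ [])) ≤ k
  length-rest₁ p le = ≤-pred (≤-trans (length-rest ([] ∷ []) λ { (here refl) → p }) le)

  length-rest₂ : ∀ {x e g k} → IsEnd G e x → IsEnd G g x → e ≢ g → length (inc x) ≤ suc (suc k) →
    length (rest x (e ∷ g ∷ [])) ≤ k
  length-rest₂ p q e≢g le = ≤-pred (≤-pred (≤-trans
    (length-rest ((e≢g ∷ []) ∷ [] ∷ []) λ { (here refl) → p ; (there (here refl)) → q }) le))

  -- When the count works whichever edges of the list are already colored, the order of coloring
  -- does not matter.
  order-any : ∀ {c} all pre es → (∀ {f} → f ∈ pre → f ∈ all) → (∀ {f} → f ∈ es → f ∈ all) →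
    (∀ {e} → e ∈ all → ∀ d → (∀ {f} → f ∉ all → d f ≡ c f) → d e ≡ nothing → ∃ (Free d e)) →
    Order c pre es
  order-any all pre [] _ _ _ = tt
  order-any all pre (e ∷ es) pre⊆ es⊆ free =
    (λ d _ same → free (es⊆ (here refl)) d (λ p → same (p ∘ pre⊆))) ,
    order-any all (e ∷ pre) es (λ { (here refl) → es⊆ (here refl) ; (there p) → pre⊆ p }) (es⊆ ∘ there) free

  abstract
    extend-any : ∀ {c} es → Valid c →
      (∀ {e} → e ∈ es → ∀ d → (∀ {f} → f ∉ es → d f ≡ c f) → d e ≡ nothing → ∃ (Free d e)) →
      ∃[ d ] Valid d × c ⊑ d × (∀ {f} → f ∉ es → d f ≡ c f) × (∀ {e} → e ∈ es → Colored d e)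
    extend-any es v free with extend [] es (order-any es [] es (λ ()) id free) v id (λ _ → refl)
    ... | d , v′ , sub , same , col = d , v′ , sub , same (λ ()) , col

  -- Precolorings whose edges form a matching

  Disjoint : E → E → Set
  Disjoint e f = ∀ {x} → IsEnd G e x → ¬ IsEnd G f x

  -- Disjointness is required whatever the two colors are: it makes the precolored edges a matching,
  -- so that a vertex meets at most one of them.
  Compatible : E × Color → E × Color → Set
  Compatible (e , k) (f , l) = Disjoint e f × (k ≡ l → ¬ Conflict G e f)

  compatible-sym : ∀ {p q} → Compatible p q → Compatible q p
  compatible-sym (d , ¬con) = (λ p q → d q p) , λ eq con → ¬con (sym eq) (conflict-sym con)

  paint : List (E × Color) → Partial
  paint [] = λ _ → nothing
  paint ((e , k) ∷ ps) = paint ps [ e ≔ k ]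

  paint⁻ : ∀ ps {e k} → paint ps e ≡ just k → (e , k) ∈ ps
  paint⁻ ((f , l) ∷ ps) {e} p with e ≟ f
  ... | yes refl with refl ← p = here refl
  ... | no _ = there (paint⁻ ps p)

  paint-nothing : ∀ ps {e} → (∀ {k} → (e , k) ∉ ps) → paint ps e ≡ nothing
  paint-nothing ps {e} e∉ with colored? (paint ps) e
  ... | inj₁ (k , eq) = contradiction (paint⁻ ps eq) e∉
  ... | inj₂ un = un

  disjoint⇒≢ : ∀ {e f} → Disjoint e f → e ≢ f
  disjoint⇒≢ d refl = d (inj₁ refl) (inj₁ refl)

  paint⁺ : ∀ {ps e k} → AllPairs Compatible ps → (e , k) ∈ ps → paint ps e ≡ just k
  paint⁺ {(e , k) ∷ ps} (_ ∷ _) (here refl) = update-same (paint ps) e k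
  paint⁺ {(f , l) ∷ ps} {e} (d ∷ ds) (there p) =
    trans (update-other (paint ps) (λ { refl → disjoint⇒≢ (proj₁ (All.lookup d p)) refl })) (paint⁺ ds p)

  paint-valid : ∀ {ps} → AllPairs Compatible ps → Valid (paint ps)
  paint-valid {ps} d e≢f con p q with lookupPairs compatible-sym d (paint⁻ ps p) (paint⁻ ps q)
  ... | inj₁ refl = e≢f refl
  ... | inj₂ (_ , ¬con) = ¬con refl con

  paint-matching : ∀ {ps e f x} → AllPairs Compatible ps → IsEnd G e x → IsEnd G f x →
    Colored (paint ps) e → Colored (paint ps) f → e ≡ f
  paint-matching {ps} d p q (_ , ce) (_ , cf) with lookupPairs compatible-sym d (paint⁻ ps ce) (paint⁻ ps cf)
  ... | inj₁ refl = refl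
  ... | inj₂ (dis , _) = contradiction q (dis p)

  -- Coloring all edges that avoid a set of vertices

  Touch : E → List V → Set
  Touch e S = ∃[ x ] IsEnd G e x × x ∈ S

  touch? : ∀ e S → Dec (Touch e S)
  touch? e S = any? λ x → end? e x ×-dec (_∈?_ _≟_ x S)

  Closed : List V → Set
  Closed S = ∀ {g x y} → Join g x y → x ∈ S → y ∈ S

  -- The field `touching` is an equation because the greedy count needs the edges at `S` to be
  -- uncolored apart from the precoloring.
  record Extension (S : List V) (ps : List (E × Color)) : Set where
    field
      coloring : Partial
      valid : Valid coloring
      extends : paint ps ⊑ coloring
      touching : ∀ {e} → Touch e S → coloring e ≡ paint ps e
      avoiding : ∀ {e} → ¬ Touch e S → Colored coloring e

  -- By `nearby` the precolored edges lie in the component of `v`, so they cannot interfere with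
  -- colors given elsewhere. `finish` starts from a coloring in which the edges at `v` carry only
  -- the precoloring.
  record Plan (v : V) (ps : List (E × Color)) : Set where
    field
      compatible : AllPairs Compatible ps
      nearby : ∀ {S} → Closed S → v ∈ S → ∀ {e k} → (e , k) ∈ ps → Touch e S
      finish : ∀ {c} → Valid c → paint ps ⊑ c → (∀ {e} → IsEnd G e v → c e ≡ paint ps e) →
        ∃[ d ] Valid d × c ⊑ d × (∀ {e} → IsEnd G e v → Colored d e)

  length-subsingleton : ∀ {xs : List E} → Unique xs → (∀ {e f} → e ∈ xs → f ∈ xs → e ≡ f) → length xs ≤ 1
  length-subsingleton {[]} _ _ = z≤n
  length-subsingleton {_ ∷ []} _ _ = s≤s z≤n
  length-subsingleton {_ ∷ _ ∷ _} ((p ∷ _) ∷ _) same = contradiction (same (here refl) (there (here refl))) p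

  -- The edge e = uy sees at most one color at p, at most four at each of the two other neighbors of u and
  -- the three other neighbors of y.
  greedy-free : ∀ {ps S u p g e y d} → AllPairs Compatible ps → p ∈ S → Join g u p → Join e u y → ¬ Touch e S →
    (∀ {f} → Touch f S → d f ≡ paint ps f) → d e ≡ nothing → ∃ (Free d e)
  greedy-free {ps} {S} {u} {p} {g} {e} {y} {d} comp p∈ jg je away same un =
    free-color {L = L} je un len
      (side-stars {hs = rest u (e ∷ g ∷ [])} {λ h → Join h u y} (∈-++⁺ʳ B₀ ∘ ∈-++⁺ˡ) λ {h} q h≢e h∉ → inj₂ (p , at-p h q h≢e h∉ , seen-p))
      (side-stars {hs = rest y (e ∷ [])} {λ _ → ⊥} (∈-++⁺ʳ B₀ ∘ ∈-++⁺ʳ B₁)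
        λ q h≢e h∉ → contradiction (∈-rest q (λ { (here r) → h≢e r })) h∉)
    where
    painted? : ∀ f → Dec (Colored (paint ps) f)
    painted? f with colored? (paint ps) f
    ... | inj₁ col = yes col
    ... | inj₂ un = no λ (_ , eq) → nothing≢just {paint ps} un eq

    B₀ B₁ B₂ L : List E
    B₀ = filter painted? (inc p)
    B₁ = stars u (rest u (e ∷ g ∷ []))
    B₂ = stars y (rest y (e ∷ []))
    L = B₀ ++ B₁ ++ B₂

    e≢g : e ≢ g
    e≢g refl = away (p , join-endʳ jg , p∈)

    length-B₀ : length B₀ ≤ 1
    length-B₀ = length-subsingleton (Unique.filter⁺ painted? (inc-unique p)) λ q r →
      let q₁ , q₂ = ∈-filter⁻ painted? {xs = inc p} q
          r₁ , r₂ = ∈-filter⁻ painted? {xs = inc p} r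
      in paint-matching comp (inc-∈ {x = p} q₁) (inc-∈ {x = p} r₁) q₂ r₂

    len : length L ≤ 21
    -- The count is 1 + 2 · 4 + 3 · 4 = 21.
    len = ≤-trans (≤-reflexive (trans (length-++ B₀) (cong (length B₀ +_) (length-++ B₁))))
      (+-mono-≤ length-B₀ (+-mono-≤
        (length-stars u (rest u (e ∷ g ∷ [])) (length-rest₂ (join-endˡ je) (join-endˡ jg) e≢g (length-inc u)))
        (length-stars y (rest y (e ∷ [])) (length-rest₁ (join-endʳ je) (length-inc y)))))

    at-p : ∀ h → IsEnd G h u → h ≢ e → h ∉ rest u (e ∷ g ∷ []) → Join h u p
    at-p h q h≢e h∉ = [ (λ { refl → jg }) ,
      (λ h≢g → contradiction (∈-rest q λ { (here r) → h≢e r ; (there (here r)) → h≢g r }) h∉) ]′ (decide (h ≟ g))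

    seen-p : ∀ {f} → IsEnd G f p → Seen d L f
    seen-p {f} q eq = f , ∈-++⁺ˡ (∈-filter⁺ painted? (∈-inc q) (_ , trans (sym (same (p , q , p∈))) eq)) , eq

  -- Only the edges at `u` that avoid `S` have to be colored when `u` leaves the set. Each has a
  -- free color because of the edge from `u` to `p`, a vertex that stays.
  greedy-step : ∀ {ps S u p g} → AllPairs Compatible ps → p ∈ S → Join g u p → Extension (u ∷ S) ps → Extension S ps
  greedy-step {ps} {S} {u} {p} {g} comp p∈ jg ext = record
    { coloring = d
    ; valid = proj₁ (proj₂ new)
    ; extends = λ eq → proj₁ (proj₂ (proj₂ new)) (extends eq)
    ; touching = touching-d
    ; avoiding = λ {e} away → avoiding-d e away
    }
    where
    open Extension ext
    es : List E
    es = filter (λ e → ¬? (touch? e S)) (inc u)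

    es-∈ : ∀ {e} → e ∈ es → IsEnd G e u × ¬ Touch e S
    es-∈ q = let q₁ , q₂ = ∈-filter⁻ (λ e → ¬? (touch? e S)) {xs = inc u} q in inc-∈ {x = u} q₁ , q₂

    grow : ∀ {f} → Touch f S → Touch f (u ∷ S)
    grow (x , q , x∈) = x , q , there x∈

    new : ∃[ d ] Valid d × coloring ⊑ d × (∀ {f} → f ∉ es → d f ≡ coloring f) × (∀ {e} → e ∈ es → Colored d e)
    new = extend-any es valid λ {e} e∈ d same un →
      let at , away = es-∈ e∈ in
      greedy-free comp p∈ jg (join-other at) away
        (λ t → trans (same (λ f∈ → proj₂ (es-∈ f∈) t)) (touching (grow t))) un

    d : Partial
    d = proj₁ new

    same-d : ∀ {f} → f ∉ es → d f ≡ coloring f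
    same-d = proj₁ (proj₂ (proj₂ (proj₂ new)))

    touching-d : ∀ {e} → Touch e S → d e ≡ paint ps e
    touching-d t = trans (same-d (λ f∈ → proj₂ (es-∈ f∈) t)) (touching (grow t))

    avoiding-d : ∀ e → ¬ Touch e S → Colored d e
    avoiding-d e away with end? e u
    ... | yes at = proj₂ (proj₂ (proj₂ (proj₂ new))) (∈-filter⁺ (λ e → ¬? (touch? e S)) (∈-inc at) away)
    ... | no ¬at =
      let k , eq = avoiding λ { (x , q , here refl) → ¬at q ; (x , q , there x∈) → away (x , q , x∈) }
      in k , proj₁ (proj₂ (proj₂ new)) eq

  -- The vertices outside S form a union of components.
  module _ (plan : ∀ {S v} → Closed S → v ∉ S → ∃[ w ] w ∉ S × ∃[ ps ] Plan w ps) where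

    private
      closed? : ∀ S → (∃[ g ] ∃[ u ] ∃[ p ] Join g u p × u ∉ S × p ∈ S) ⊎ Closed S
      closed? S with search (λ g → crossing g)
        where
        crossing : ∀ g → (∃[ u ] ∃[ p ] Join g u p × u ∉ S × p ∈ S) ⊎ (∀ {x y} → Join g x y → x ∈ S → y ∈ S)
        crossing g with _∈?_ _≟_ (proj₁ (ends G g)) S | _∈?_ _≟_ (proj₂ (ends G g)) S
        ... | yes p | yes q = inj₂ λ { (inj₁ (refl , refl)) _ → q ; (inj₂ (refl , refl)) _ → p }
        ... | no p | no q = inj₂ λ { (inj₁ (refl , refl)) r → contradiction r p ; (inj₂ (refl , refl)) r → contradiction r q }
        ... | yes p | no q = inj₁ (_ , _ , inj₂ (refl , refl) , q , p)
        ... | no p | yes q = inj₁ (_ , _ , inj₁ (refl , refl) , p , q)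
      ... | inj₁ (g , x) = inj₁ (g , x)
      ... | inj₂ c = inj₂ λ {g} → c g

      covered? : ∀ (S : List V) → (∃[ v ] v ∉ S) ⊎ (∀ v → v ∈ S)
      covered? S = search λ v → [ inj₂ , inj₁ ]′ (decide (_∈?_ _≟_ v S))

      unique-∷ : ∀ {x} {S : List V} → x ∉ S → Unique S → Unique (x ∷ S)
      unique-∷ x∉ u = All.tabulate (λ { p refl → x∉ p }) ∷ u

      no-room : ∀ {x} {S : List V} → x ∉ S → Unique S → ¬ n G ≤ length S + 0
      no-room {S = S} x∉ u le = <⇒≱ (unique-⊆⇒length≤ (unique-∷ x∉ u) (λ {x} _ → ∈-allFin x))
        (≤-trans (≤-reflexive (length-tabulate id)) (≤-trans le (≤-reflexive (+-identityʳ (length S)))))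

      more-room : ∀ {k} (S : List V) → n G ≤ length S + suc k → n G ≤ suc (length S) + k
      more-room S le = ≤-trans le (≤-reflexive (+-suc (length S) _))

      -- A conflict never leads out of a closed set. The precolored edges touch `S` and the edges
      -- colored by `coloring` avoid it, so the two colorings can be put together.
      merge : ∀ {v S ps} → Plan v ps → v ∈ S → Closed S → Extension S [] → Extension S ps
      merge {v} {S} {ps} pl v∈ closed ext = record
        { coloring = d
        ; valid = valid-d
        ; extends = extends-d
        ; touching = touching-d
        ; avoiding = avoiding-d
        }
        where
        open Plan pl
        open Extension ext

        d : Partial
        d e = paint ps e <∣> coloring e

        extends-d : paint ps ⊑ d
        extends-d eq = cong (_<∣> _) eq

        touching-d : ∀ {e} → Touch e S → d e ≡ paint ps e
        touching-d {e} t with paint ps e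
        ... | just _ = refl
        ... | nothing = touching t

        avoiding-d : ∀ {e} → ¬ Touch e S → Colored d e
        avoiding-d {e} away with paint ps e
        ... | just k = k , refl
        ... | nothing = avoiding away

        spread : ∀ {e f} → Conflict G e f → Touch e S → Touch f S
        spread {e} {f} con (z , q , z∈) with end-join {e} q
        spread (inj₁ (x , p , r)) (z , q , z∈) | y , j with join-end j p
        ... | inj₁ refl = x , r , z∈
        ... | inj₂ refl = x , r , closed j z∈
        spread (inj₂ (g , x , w , p , r , jg)) (z , q , z∈) | y , j with join-end j p
        ... | inj₁ refl = w , r , closed jg z∈
        ... | inj₂ refl = w , r , closed jg (closed j z∈)

        split : ∀ {e k} → d e ≡ just k → (paint ps e ≡ just k × Touch e S) ⊎ (coloring e ≡ just k × ¬ Touch e S)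
        split {e} eq with paint ps e in eq′
        ... | just k with refl ← eq = inj₁ (refl , nearby closed v∈ (paint⁻ ps eq′))
        ... | nothing = inj₂ (eq , λ t → nothing≢just {coloring} (touching t) eq)

        valid-d : Valid d
        valid-d e≢f con p q with split p | split q
        ... | inj₁ (p′ , _) | inj₁ (q′ , _) = paint-valid compatible e≢f con p′ q′
        ... | inj₂ (p′ , _) | inj₂ (q′ , _) = valid e≢f con p′ q′
        ... | inj₁ (_ , t) | inj₂ (_ , away) = away (spread con t)
        ... | inj₂ (_ , away) | inj₁ (_ , t) = away (spread (conflict-sym con) t)

      -- After the edges at `v` are finished, all colors at `S` are erased, so that nothing painted
      -- there outlives the plan. Erasing creates no clash, and the edges that avoid `S` are all
      -- colored by then.
      complete : ∀ {v S ps} → Plan v ps → Extension (v ∷ S) ps → Extension S []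
      complete {v} {S} {ps} pl ext = record
        { coloring = d
        ; valid = valid-d
        ; extends = λ ()
        ; touching = touching-d
        ; avoiding = avoiding-d
        }
        where
        open Plan pl
        open Extension ext

        done : ∃[ d ] Valid d × coloring ⊑ d × (∀ {e} → IsEnd G e v → Colored d e)
        done = finish valid extends λ p → touching (_ , p , here refl)

        d : Partial
        d e = if does (touch? e S) then nothing else proj₁ done e

        restrict : ∀ {e k} → d e ≡ just k → proj₁ done e ≡ just k
        restrict {e} eq with touch? e S
        ... | no _ = eq

        valid-d : Valid d
        valid-d e≢f con p q = proj₁ (proj₂ done) e≢f con (restrict p) (restrict q)

        touching-d : ∀ {e} → Touch e S → d e ≡ nothing
        touching-d {e} t rewrite dec-true (touch? e S) t = refl

        colored-done : ∀ {e} → ¬ Touch e S → Colored (proj₁ done) e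
        colored-done {e} away with end? e v
        ... | yes p = proj₂ (proj₂ (proj₂ done)) p
        ... | no ¬p =
          let k , eq = avoiding λ { (x , q , here refl) → ¬p q ; (x , q , there x∈) → away (x , q , x∈) }
          in k , proj₁ (proj₂ (proj₂ done)) eq

        avoiding-d : ∀ {e} → ¬ Touch e S → Colored d e
        avoiding-d {e} away rewrite dec-false (touch? e S) away = colored-done away

      -- Mutual induction on `k`, a bound on the number of vertices outside `S`. If `S` is closed,
      -- growth starts afresh from a planned vertex; otherwise a vertex joined to `S` is added. On
      -- the way back the added vertex is removed by `complete` or by `greedy-step`.
      avoid-closed : ∀ k S → n G ≤ length S + k → Unique S → Closed S → Extension S []
      avoid-set : ∀ k S {v ps} → n G ≤ length S + k → Unique S → v ∈ S → Plan v ps → Extension S ps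

      avoid-closed k S le u closed with covered? S
      ... | inj₂ all = record
        { coloring = λ _ → nothing
        ; valid = λ _ _ ()
        ; extends = λ ()
        ; touching = λ _ → refl
        ; avoiding = λ {e} away → contradiction (_ , inj₁ refl , all _) away
        }
      ... | inj₁ (v , v∉) with plan closed v∉
      avoid-closed zero S le u closed | inj₁ (v , v∉) | _ = contradiction le (no-room v∉ u)
      avoid-closed (suc k) S le u closed | inj₁ _ | w , w∉ , ps , pl =
        complete pl (avoid-set k (w ∷ S) (more-room S le) (unique-∷ w∉ u) (here refl) pl)

      avoid-set k S le u v∈ pl with closed? S
      ... | inj₂ closed = merge pl v∈ closed (avoid-closed k S le u closed)
      avoid-set zero S le u v∈ pl | inj₁ (_ , x , _ , _ , x∉ , _) = contradiction le (no-room x∉ u)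
      avoid-set (suc k) S le u v∈ pl | inj₁ (g , x , p , j , x∉ , p∈) =
        greedy-step (Plan.compatible pl) p∈ j
          (avoid-set k (x ∷ S) (more-room S le) (unique-∷ x∉ u) (there v∈) pl)

    strong-coloring : Σ (E → Color) (IsStrongEdgeColoring G 22)
    strong-coloring =
      let col = λ e → avoiding {e} λ { (_ , _ , ()) }
      in proj₁ ∘ col , λ e f e≢f con same → valid e≢f con (proj₂ (col e)) (trans (proj₂ (col f)) (cong just (sym same)))
      where open Extension (avoid-closed (n G) [] ≤-refl [] λ _ ())

  -- Neighborhoods

  -- A vertex of degree four without loops or parallel edges. The four neighbors have fixed
  -- positions, so that symmetric arguments are reused by permuting them.
  record Nbhd (x a b c d : V) : Set where
    field
      joinᵃ : ∃[ g ] Join g x a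
      joinᵇ : ∃[ g ] Join g x b
      joinᶜ : ∃[ g ] Join g x c
      joinᵈ : ∃[ g ] Join g x d
      a≢b : a ≢ b
      a≢c : a ≢ c
      a≢d : a ≢ d
      b≢c : b ≢ c
      b≢d : b ≢ d
      c≢d : c ≢ d
      loopless : ∀ {g} → ¬ Join g x x
      simple : ∀ {f g y} → Join f x y → Join g x y → f ≡ g
      cover : ∀ {g} → IsEnd G g x → Join g x a ⊎ Join g x b ⊎ Join g x c ⊎ Join g x d

  swap₁₂ : ∀ {x a b c d} → Nbhd x a b c d → Nbhd x b a c d
  swap₁₂ N = record
    { joinᵃ = joinᵇ ; joinᵇ = joinᵃ ; joinᶜ = joinᶜ ; joinᵈ = joinᵈ
    ; a≢b = a≢b ∘ sym ; a≢c = b≢c ; a≢d = b≢d ; b≢c = a≢c ; b≢d = a≢d ; c≢d = c≢d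
    ; loopless = loopless ; simple = simple
    ; cover = [ inj₂ ∘ inj₁ , [ inj₁ , inj₂ ∘ inj₂ ]′ ]′ ∘ cover
    }
    where open Nbhd N

  swap₂₃ : ∀ {x a b c d} → Nbhd x a b c d → Nbhd x a c b d
  swap₂₃ N = record
    { joinᵃ = joinᵃ ; joinᵇ = joinᶜ ; joinᶜ = joinᵇ ; joinᵈ = joinᵈ
    ; a≢b = a≢c ; a≢c = a≢b ; a≢d = a≢d ; b≢c = b≢c ∘ sym ; b≢d = c≢d ; c≢d = b≢d
    ; loopless = loopless ; simple = simple
    ; cover = [ inj₁ , [ inj₂ ∘ inj₂ ∘ inj₁ , [ inj₂ ∘ inj₁ , inj₂ ∘ inj₂ ∘ inj₂ ]′ ]′ ]′ ∘ cover
    }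
    where open Nbhd N

  swap₃₄ : ∀ {x a b c d} → Nbhd x a b c d → Nbhd x a b d c
  swap₃₄ N = record
    { joinᵃ = joinᵃ ; joinᵇ = joinᵇ ; joinᶜ = joinᵈ ; joinᵈ = joinᶜ
    ; a≢b = a≢b ; a≢c = a≢d ; a≢d = a≢c ; b≢c = b≢d ; b≢d = b≢c ; c≢d = c≢d ∘ sym
    ; loopless = loopless ; simple = simple
    ; cover = [ inj₁ , [ inj₂ ∘ inj₁ , [ inj₂ ∘ inj₂ ∘ inj₂ , inj₂ ∘ inj₂ ∘ inj₁ ]′ ]′ ]′ ∘ cover
    }
    where open Nbhd N

  third : ∀ {x a b c d} → Nbhd x a b c d → Nbhd x c a b d
  third = swap₁₂ ∘ swap₂₃

  fourth : ∀ {x a b c d} → Nbhd x a b c d → Nbhd x d a b c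
  fourth = third ∘ swap₃₄

  Nbhd₁ : V → V → Set
  Nbhd₁ x a = ∃[ b ] ∃[ c ] ∃[ d ] Nbhd x a b c d

  Nbhd₂ : V → V → V → Set
  Nbhd₂ x a b = ∃[ c ] ∃[ d ] Nbhd x a b c d

  Nbhd₃ : V → V → V → V → Set
  Nbhd₃ x a b c = ∃[ d ] Nbhd x a b c d

  pivot₁ : ∀ {g x a b c d y} → Nbhd x a b c d → Join g x y → Nbhd₁ x y
  pivot₁ N j with Nbhd.cover N (join-endˡ j)
  ... | inj₁ j′ with refl ← join-unique j j′ = _ , _ , _ , N
  ... | inj₂ (inj₁ j′) with refl ← join-unique j j′ = _ , _ , _ , swap₁₂ N
  ... | inj₂ (inj₂ (inj₁ j′)) with refl ← join-unique j j′ = _ , _ , _ , third N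
  ... | inj₂ (inj₂ (inj₂ j′)) with refl ← join-unique j j′ = _ , _ , _ , fourth N

  pivot₂ : ∀ {g x a b c d y} → Nbhd x a b c d → Join g x y → y ≢ a → Nbhd₂ x a y
  pivot₂ N j y≢a with Nbhd.cover N (join-endˡ j)
  ... | inj₁ j′ = contradiction (join-unique j j′) y≢a
  ... | inj₂ (inj₁ j′) with refl ← join-unique j j′ = _ , _ , N
  ... | inj₂ (inj₂ (inj₁ j′)) with refl ← join-unique j j′ = _ , _ , swap₂₃ N
  ... | inj₂ (inj₂ (inj₂ j′)) with refl ← join-unique j j′ = _ , _ , swap₂₃ (swap₃₄ N)

  pivot₃ : ∀ {g x a b c d y} → Nbhd x a b c d → Join g x y → y ≢ a → y ≢ b → Nbhd₃ x a b y
  pivot₃ N j y≢a y≢b with Nbhd.cover N (join-endˡ j)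
  ... | inj₁ j′ = contradiction (join-unique j j′) y≢a
  ... | inj₂ (inj₁ j′) = contradiction (join-unique j j′) y≢b
  ... | inj₂ (inj₂ (inj₁ j′)) with refl ← join-unique j j′ = _ , N
  ... | inj₂ (inj₂ (inj₂ j′)) with refl ← join-unique j j′ = _ , swap₃₄ N

  join-≢ : ∀ {f g x a b} → Join f x a → Join g x b → a ≢ b → f ≢ g
  join-≢ j j′ a≢b refl = a≢b (join-unique j j′)

  -- The bound counts edges and not edge-ends, so the first alternative also covers vertices with a
  -- loop.
  Deficient : V → Set
  Deficient x = length (inc x) ≤ 3 ⊎ (∃[ e ] ∃[ f ] ∃[ y ] e ≢ f × Join e x y × Join f x y)

  deficient-or-nbhd : ∀ x → Deficient x ⊎ (∃[ a ] Nbhd₁ x a)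
  deficient-or-nbhd x with any? (λ g → join? g x x)
  ... | yes (g , j) = inj₁ (inj₁ (length-inc-loop j))
  ... | no loopless with any? (λ e → any? λ f → any? λ y → ¬? (e ≟ f) ×-dec join? e x y ×-dec join? f x y)
  ...   | yes p = inj₁ (inj₂ p)
  ...   | no ¬parallel = from-list (inc x) (inc-unique x) inc-∈ ∈-inc (length-inc x)
    where
    simple : ∀ {f g y} → Join f x y → Join g x y → f ≡ g
    simple {f} {g} j j′ with f ≟ g
    ... | yes p = p
    ... | no f≢g = contradiction (f , g , _ , f≢g , j , j′) ¬parallel

    -- A variable list stands in for `inc x`, so that its shape can be split; it has the same
    -- members and no repetitions.
    from-list : (es : List E) → Unique es → (∀ {g} → g ∈ es → IsEnd G g x) → (∀ {g} → IsEnd G g x → g ∈ es) →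
      length es ≤ 4 → (length (inc x) ≤ 3 ⊎ (∃[ e ] ∃[ f ] ∃[ y ] e ≢ f × Join e x y × Join f x y)) ⊎ (∃[ a ] Nbhd₁ x a)
    from-list es u at all le with length es ℕ.≤? 3
    from-list es u at all le | yes short = inj₁ (inj₁ (≤-trans (unique-⊆⇒length≤ (inc-unique x) (all ∘ inc-∈)) short))
    from-list [] u at all le | no ¬short = contradiction z≤n ¬short
    from-list (_ ∷ []) u at all le | no ¬short = contradiction (s≤s z≤n) ¬short
    from-list (_ ∷ _ ∷ []) u at all le | no ¬short = contradiction (s≤s (s≤s z≤n)) ¬short
    from-list (_ ∷ _ ∷ _ ∷ []) u at all le | no ¬short = contradiction (s≤s (s≤s (s≤s z≤n))) ¬short
    from-list (_ ∷ _ ∷ _ ∷ _ ∷ _ ∷ _) u at all (s≤s (s≤s (s≤s (s≤s ())))) | no _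
    from-list (e ∷ f ∷ g ∷ h ∷ []) ((ef ∷ eg ∷ eh ∷ []) ∷ (fg ∷ fh ∷ []) ∷ (gh ∷ []) ∷ _) at all le | no _ =
      inj₂ (_ , _ , _ , _ , record
        { joinᵃ = e , je ; joinᵇ = f , jf ; joinᶜ = g , jg ; joinᵈ = h , jh
        ; a≢b = apart je jf ef ; a≢c = apart je jg eg ; a≢d = apart je jh eh
        ; b≢c = apart jf jg fg ; b≢d = apart jf jh fh ; c≢d = apart jg jh gh
        ; loopless = λ j → loopless (_ , j) ; simple = simple ; cover = cover ∘ all
        })
      where
      je : Join e x (other x e)
      je = join-other (at (here refl))
      jf : Join f x (other x f)
      jf = join-other (at (there (here refl)))
      jg : Join g x (other x g)
      jg = join-other (at (there (there (here refl))))
      jh : Join h x (other x h)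
      jh = join-other (at (there (there (there (here refl)))))

      apart : ∀ {e f y z} → Join e x y → Join f x z → e ≢ f → y ≢ z
      apart j j′ e≢f refl = e≢f (simple j j′)

      cover : ∀ {k} → k ∈ e ∷ f ∷ g ∷ h ∷ [] →
        Join k x (other x e) ⊎ Join k x (other x f) ⊎ Join k x (other x g) ⊎ Join k x (other x h)
      cover (here refl) = inj₁ je
      cover (there (here refl)) = inj₂ (inj₁ jf)
      cover (there (there (here refl))) = inj₂ (inj₂ (inj₁ jg))
      cover (there (there (there (here refl)))) = inj₂ (inj₂ (inj₂ jh))

  -- Redundant colors

  -- A share of the count: the edges at `center` except those in `dropped`. The bound `size` is
  -- stored as a number so that the total of a list of pieces can be compared with 21 by evaluation.
  record Piece : Set where
    field
      center : V
      dropped : List E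
      size : ℕ
      bound : length (rest center dropped) ≤ size

  open Piece

  full : V → Piece
  full x = record { center = x ; dropped = [] ; size = 4 ; bound = ≤-trans (length-rest [] λ ()) (length-inc x) }

  drop₁ : ∀ {g} x → IsEnd G g x → Piece
  drop₁ {g} x p = record { center = x ; dropped = g ∷ [] ; size = 3 ; bound = length-rest₁ p (length-inc x) }

  drop₂ : ∀ {g h} x → IsEnd G g x → IsEnd G h x → g ≢ h → Piece
  drop₂ {g} {h} x p q g≢h =
    record { center = x ; dropped = g ∷ h ∷ [] ; size = 2 ; bound = length-rest₂ p q g≢h (length-inc x) }

  Kept : List Piece → E → Set
  Kept ps g = Any (λ p → IsEnd G g (center p) × g ∉ dropped p) ps

  -- The edge `h` of the same color has to be kept, which rules out that two edges are dropped in
  -- favor of each other.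
  Redundant : Partial → List Piece → E → Set
  Redundant c ps g = c g ≡ nothing ⊎ (∃[ h ] Kept ps h × c g ≡ c h)

  kept : Piece → List E
  kept p = rest (center p) (dropped p)

  length-kept : ∀ ps → length (concatMap kept ps) ≤ sum (map size ps)
  length-kept [] = z≤n
  length-kept (p ∷ ps) = ≤-trans (≤-reflexive (length-++ (kept p))) (+-mono-≤ (bound p) (length-kept ps))

  piece-seen : ∀ {c ps} → All (λ p → All (Redundant c ps) (dropped p)) ps → ∀ {x} → x ∈ map center ps →
    ∀ {g} → IsEnd G g x → Seen c (concatMap kept ps) g
  piece-seen {c} {ps} good {x} x∈ {g} q {k} eq with ∈-map⁻ center x∈
  ... | p , p∈ , refl with _∈?_ _≟_ g (dropped p)
  ...   | no g∉ = g , ∈-concatMap⁺ kept (Any.map (λ { refl → ∈-rest q g∉ }) p∈) , eq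
  ...   | yes g∈ with All.lookup (All.lookup good p∈) g∈
  ...     | inj₁ un = contradiction eq (nothing≢just {c} un)
  ...     | inj₂ (h , h-kept , same) =
    h , ∈-concatMap⁺ kept (Any.map (λ (r , h∉) → ∈-rest r h∉) h-kept) , trans (sym same) eq

  side-pieces : ∀ {d L e x y a b c} → Nbhd x y a b c → Join e x y →
    All (λ z → ∀ g → IsEnd G g z → Seen d L g) (a ∷ b ∷ c ∷ []) → ∀ {Except} → Side d L e x Except
  side-pieces N j (sa ∷ sb ∷ sc ∷ []) p g≢e with Nbhd.cover N p
  ... | inj₁ j′ = contradiction (Nbhd.simple N j′ j) g≢e
  ... | inj₂ (inj₁ j′) = inj₂ (_ , j′ , λ {g} → sa g)
  ... | inj₂ (inj₂ (inj₁ j′)) = inj₂ (_ , j′ , λ {g} → sb g)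
  ... | inj₂ (inj₂ (inj₂ j′)) = inj₂ (_ , j′ , λ {g} → sc g)

  -- The colors seen by e = xy occur at the (at most six) other neighbors of x and y. A color may be
  -- dropped at one of these if the edge carrying it is uncolored or its color is kept elsewhere.
  free-pieces : ∀ {d e x y a₁ a₂ a₃ b₁ b₂ b₃} → Nbhd x y a₁ a₂ a₃ → Nbhd y x b₁ b₂ b₃ → Join e x y → d e ≡ nothing →
    (ps : List Piece) → All (_∈ map center ps) (a₁ ∷ a₂ ∷ a₃ ∷ []) → All (_∈ map center ps) (b₁ ∷ b₂ ∷ b₃ ∷ []) →
    {True (sum (map size ps) ℕ.≤? 21)} → All (λ p → All (Redundant d ps) (dropped p)) ps → ∃ (Free d e)
  free-pieces {d} {x = x} {y} Nx Ny j un ps a∈ b∈ {small} good = free-color {L = concatMap kept ps} j un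
    (≤-trans (length-kept ps) (toWitness small))
    (side-pieces Nx j (All.map (λ z g → piece-seen {d} {ps} good z) a∈) {λ g → Join g x y})
    (side-pieces Ny (join-sym j) (All.map (λ z g → piece-seen {d} {ps} good z) b∈))

  -- One piece for each of the six neighbors, in order. In a triangle one piece serves both ends,
  -- and `free-pieces` is used directly.
  free-pieces₆ : ∀ {d e x y a₁ a₂ a₃ b₁ b₂ b₃} → Nbhd x y a₁ a₂ a₃ → Nbhd y x b₁ b₂ b₃ → Join e x y → d e ≡ nothing →
    (ps : List Piece) → map center ps ≡ a₁ ∷ a₂ ∷ a₃ ∷ b₁ ∷ b₂ ∷ b₃ ∷ [] →
    {True (sum (map size ps) ℕ.≤? 21)} → All (λ p → All (Redundant d ps) (dropped p)) ps → ∃ (Free d e)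
  free-pieces₆ Nx Ny j un ps eq {small} = free-pieces Nx Ny j un ps
    (subst (λ zs → All (_∈ zs) _) (sym eq) (here refl ∷ there (here refl) ∷ there (there (here refl)) ∷ []))
    (subst (λ zs → All (_∈ zs) _) (sym eq) (there (there (there (here refl))) ∷
      there (there (there (there (here refl)))) ∷ there (there (there (there (there (here refl))))) ∷ []))
    {small}

  Sequence : Partial → List E → Set
  Sequence c [] = ⊤
  Sequence c (e ∷ es) = (∀ d → c ⊑ d → All (λ f → d f ≡ nothing) (e ∷ es) → ∃ (Free d e)) × Sequence c es

  -- Since the list has no repetitions, no later edge is among those processed, and it is as
  -- uncolored as it was in `c`.
  extend-sequence : ∀ {c} es → Valid c → Unique es → All (λ e → c e ≡ nothing) es → Sequence c es →
    ∃[ d ] Valid d × c ⊑ d × (∀ {e} → e ∈ es → Colored d e)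
  extend-sequence {c} es v u un seq =
    let d , v′ , sub , _ , col = extend [] es (order [] es u (λ _ ()) un seq) v id (λ _ → refl)
    in d , v′ , sub , col
    where
    order : ∀ pre es → Unique es → (∀ {e} → e ∈ es → e ∉ pre) → All (λ e → c e ≡ nothing) es → Sequence c es → Order c pre es
    order pre [] _ _ _ _ = tt
    order pre (e ∷ es) (e∉ ∷ u) away (_ ∷ un) (free , seq) =
      (λ d sub same une → free d sub
        (une ∷ All.tabulate λ p → trans (same (away (there p))) (All.lookup un p))) ,
      order (e ∷ pre) es u (λ { p (here refl) → All.lookup e∉ p refl ; p (there q) → away (there p) q }) un seq

  -- Local configurations

  Finish : V → Partial → Set
  Finish v c = ∃[ d ] Valid d × c ⊑ d × (∀ {e} → IsEnd G e v → Colored d e)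

  unpainted-plan : ∀ {v} → (∀ {c} → Valid c → (∀ {e} → IsEnd G e v → c e ≡ nothing) → Finish v c) → Plan v []
  unpainted-plan fin = record { compatible = [] ; nearby = λ _ _ () ; finish = λ valid _ same → fin valid same }

  -- Two edges at `x` and three edges at `y` besides `e` contribute at most 2 · 4 + 3 · 4 = 20
  -- edges. The remaining edges at `x` lead to vertices that are accounted for already.
  few-neighbors-free : ∀ {d e x y} hs → Join e x y → d e ≡ nothing → length hs ≤ 2 →
    (∀ {g} → IsEnd G g x → g ≢ e → g ∉ hs → Join g x y ⊎ (∃[ h ] ∃[ z ] h ∈ hs × Join g x z × Join h x z)) →
    ∃ (Free d e)
  few-neighbors-free {d} {e} {x} {y} hs j un short parallel = free-color {L = L} j un
    (≤-trans (≤-reflexive (length-++ (stars x hs)))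
      (≤-trans (+-mono-≤ (length-stars x hs short)
        (length-stars y (rest y (e ∷ [])) (length-rest₁ (join-endʳ j) (length-inc y)))) (n≤1+n _)))
    (side-stars {hs = hs} {λ g → Join g x y} ∈-++⁺ˡ λ p g≢e g∉ → leftover (parallel p g≢e g∉))
    (side-stars {hs = rest y (e ∷ [])} {λ _ → ⊥} (∈-++⁺ʳ (stars x hs))
      λ p g≢e g∉ → contradiction (∈-rest p (λ { (here r) → g≢e r })) g∉)
    where
    L : List E
    L = stars x hs ++ stars y (rest y (e ∷ []))

    at-other : ∀ {h z} → h ∈ hs → Join h x z → ∀ {f} → IsEnd G f z → Seen d L f
    at-other h∈ j {f} p eq with refl ← join-unique j (join-other (join-endˡ j)) =
      f , ∈-++⁺ˡ (∈-concatMap⁺ (inc ∘ other x) (Any.map (λ { refl → ∈-inc p }) h∈)) , eq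

    leftover : ∀ {g} → Join g x y ⊎ (∃[ h ] ∃[ z ] h ∈ hs × Join g x z × Join h x z) →
      Join g x y ⊎ (∃[ z ] Join g x z × (∀ {f} → IsEnd G f z → Seen d L f))
    leftover (inj₁ j) = inj₁ j
    leftover (inj₂ (h , z , h∈ , jg , jh)) = inj₂ (z , jg , at-other h∈ jh)

  -- With at most three edges at `x`, two are left besides `e`. With parallel edges, one of them can
  -- be left out: it leads to `y` if `e` is its twin, and otherwise to the same vertex as its twin,
  -- which is counted.
  deficient-free : ∀ {d e x y} → Deficient x → Join e x y → d e ≡ nothing → ∃ (Free d e)
  deficient-free {e = e} {x} (inj₁ short) j un = few-neighbors-free (rest x (e ∷ [])) j un (length-rest₁ (join-endˡ j) short)
    λ p g≢e g∉ → contradiction (∈-rest p λ { (here r) → g≢e r }) g∉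
  deficient-free {e = e} {x} (inj₂ (f , f′ , z , f≢f′ , jf , jf′)) j un with e ≟ f | e ≟ f′
  ... | yes refl | _ with refl ← join-unique j jf =
    few-neighbors-free (rest x (e ∷ f′ ∷ [])) j un (length-rest₂ (join-endˡ j) (join-endˡ jf′) f≢f′ (length-inc x))
    λ {g} p g≢e g∉ → [ (λ { refl → inj₁ jf′ }) ,
      (λ g≢f′ → contradiction (∈-rest p λ { (here r) → g≢e r ; (there (here r)) → g≢f′ r }) g∉) ]′ (decide (g ≟ f′))
  ... | no e≢f | yes refl with refl ← join-unique j jf′ =
    few-neighbors-free (rest x (e ∷ f ∷ [])) j un (length-rest₂ (join-endˡ j) (join-endˡ jf) e≢f (length-inc x))
    λ {g} p g≢e g∉ → [ (λ { refl → inj₁ jf }) ,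
      (λ g≢f → contradiction (∈-rest p λ { (here r) → g≢e r ; (there (here r)) → g≢f r }) g∉) ]′ (decide (g ≟ f))
  ... | no e≢f | no e≢f′ =
    few-neighbors-free (rest x (e ∷ f ∷ [])) j un (length-rest₂ (join-endˡ j) (join-endˡ jf) e≢f (length-inc x))
    λ {g} p g≢e g∉ → [ (λ { refl → inj₂ (f′ , z , ∈-rest (join-endˡ jf′) f′∉ , jf , jf′) }) ,
      (λ g≢f → contradiction (∈-rest p λ { (here r) → g≢e r ; (there (here r)) → g≢f r }) g∉) ]′ (decide (g ≟ f))
    where
    f′∉ : f′ ∉ e ∷ f ∷ []
    f′∉ (here r) = e≢f′ (sym r)
    f′∉ (there (here r)) = f≢f′ (sym r)

  deficient-plan : ∀ {v} → Deficient v → Plan v []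
  deficient-plan {v} def = unpainted-plan λ valid _ →
    let d , v′ , sub , _ , col = extend-any (inc v) valid λ e∈ d _ un →
          deficient-free def (join-other (inc-∈ {x = v} e∈)) un
    in d , v′ , sub , λ p → col (∈-inc p)

  -- Starting from 24, the edge to `c` saves the three uncolored edges at `v`. The edge to `d` saves
  -- the two to `a` and `b`, and the edge between `a` and `b`, which is seen at both. For the last
  -- two, the third vertex of the triangle is a neighbor of both ends, so five stars of four edges
  -- remain.
  triangle-plan : ∀ {v a b c d} → Nbhd v a b c d → Nbhd₂ a v b → Nbhd₂ b v a → Nbhd₁ c v → Nbhd₁ d v → Plan v []
  triangle-plan {v} {a} {b} {c} {d} Nv (a₁ , a₂ , Na) (b₁ , b₂ , Nb) (c₁ , c₂ , c₃ , Nc) (d₁ , d₂ , d₃ , Nd)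
    with Nbhd.joinᵃ Nv | Nbhd.joinᵇ Nv | Nbhd.joinᶜ Nv | Nbhd.joinᵈ Nv | Nbhd.joinᵇ Na
  ... | va , jva | vb , jvb | vc , jvc | vd , jvd | ab , jab = unpainted-plan λ valid un →
    let e , v′ , sub , col = extend-sequence (vc ∷ vd ∷ va ∷ vb ∷ []) valid unique
          (un (join-endˡ jvc) ∷ un (join-endˡ jvd) ∷ un (join-endˡ jva) ∷ un (join-endˡ jvb) ∷ [])
          ( (λ { _ _ (uc ∷ ud ∷ ua ∷ ub ∷ []) → free-pieces₆ (third Nv) Nc jvc uc
              (drop₁ a (join-endʳ jva) ∷ drop₁ b (join-endʳ jvb) ∷ drop₁ d (join-endʳ jvd) ∷ full c₁ ∷ full c₂ ∷ full c₃ ∷ [])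
              refl ((inj₁ ua ∷ []) ∷ (inj₁ ub ∷ []) ∷ (inj₁ ud ∷ []) ∷ [] ∷ [] ∷ [] ∷ []) })
          , (λ { _ _ (ud ∷ ua ∷ ub ∷ []) → free-pieces₆ (fourth Nv) Nd jvd ud
              (drop₂ a (join-endʳ jva) (join-endˡ jab) va≢ab ∷ drop₁ b (join-endʳ jvb) ∷ full c ∷ full d₁ ∷ full d₂ ∷ full d₃ ∷ [])
              refl ((inj₁ ua ∷ inj₂ (ab , there (here (join-endʳ jab , λ { (here r) → vb≢ab (sym r) })) , refl) ∷ []) ∷
                (inj₁ ub ∷ []) ∷ [] ∷ [] ∷ [] ∷ [] ∷ []) })
          , (λ { _ _ (ua ∷ ub ∷ []) → free-pieces Nv Na jva ua
              (full b ∷ full c ∷ full d ∷ full a₁ ∷ full a₂ ∷ [])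
              (here refl ∷ there (here refl) ∷ there (there (here refl)) ∷ [])
              (here refl ∷ there (there (there (here refl))) ∷ there (there (there (there (here refl)))) ∷ [])
              ([] ∷ [] ∷ [] ∷ [] ∷ [] ∷ []) })
          , (λ { _ _ (ub ∷ []) → free-pieces (swap₁₂ Nv) Nb jvb ub
              (full a ∷ full c ∷ full d ∷ full b₁ ∷ full b₂ ∷ [])
              (here refl ∷ there (here refl) ∷ there (there (here refl)) ∷ [])
              (here refl ∷ there (there (there (here refl))) ∷ there (there (there (there (here refl)))) ∷ [])
              ([] ∷ [] ∷ [] ∷ [] ∷ [] ∷ []) })
          , tt)
    in e , v′ , sub , λ p → col (listed p)
    where
    open Nbhd Nv hiding (joinᵃ; joinᵇ; joinᶜ; joinᵈ)

    va≢ab : va ≢ ab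
    va≢ab = join-≢ (join-sym {va} jva) jab (Nbhd.a≢b Na)

    vb≢ab : vb ≢ ab
    vb≢ab = join-≢ (join-sym {vb} jvb) (join-sym {ab} jab) (Nbhd.a≢b Nb)

    unique : Unique (vc ∷ vd ∷ va ∷ vb ∷ [])
    unique = (join-≢ jvc jvd c≢d ∷ join-≢ jvc jva (a≢c ∘ sym) ∷ join-≢ jvc jvb (b≢c ∘ sym) ∷ [])
      ∷ (join-≢ jvd jva (a≢d ∘ sym) ∷ join-≢ jvd jvb (b≢d ∘ sym) ∷ []) ∷ (join-≢ jva jvb a≢b ∷ []) ∷ [] ∷ []

    listed : ∀ {e} → IsEnd G e v → e ∈ vc ∷ vd ∷ va ∷ vb ∷ []
    listed p with cover p
    ... | inj₁ j = there (there (here (simple j jva)))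
    ... | inj₂ (inj₁ j) = there (there (there (here (simple j jvb))))
    ... | inj₂ (inj₂ (inj₁ j)) = here (simple j jvc)
    ... | inj₂ (inj₂ (inj₂ j)) = there (here (simple j jvd))

  nonconflict⇒disjoint : ∀ {e f} → ¬ Conflict G e f → Disjoint e f
  nonconflict⇒disjoint ¬con p q = ¬con (inj₁ (_ , p , q))

  nonconflict⇒compatible : ∀ {e f k l} → ¬ Conflict G e f → Compatible (e , k) (f , l)
  nonconflict⇒compatible ¬con = nonconflict⇒disjoint ¬con , λ _ → ¬con

  -- The edges h at b and h′ at a₁ agree in color, being either equal or precolored alike; this is the
  -- one repetition that the last edge va needs beyond ub and uc, each of which is seen twice.
  theta-finish : ∀ {v u a b c d a₁ a₂ b₁ b₂ c₁ c₂ c′ h h′} → Nbhd v a b c d → Nbhd a v u a₁ a₂ → Nbhd b v u b₁ b₂ →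
    Nbhd c v u c₁ c₂ → Nbhd₁ d v → IsEnd G h b → ¬ IsEnd G h u → IsEnd G h′ a₁ → (∀ e → c′ ⊑ e → e h ≡ e h′) →
    Valid c′ → (∀ {e} → IsEnd G e v → c′ e ≡ nothing) → Finish v c′
  theta-finish {v} {u} {a} {b} {c} {d} {a₁} {a₂} {b₁} {b₂} {c₁} {c₂} {h = h} {h′}
    Nv Na Nb Nc (d₁ , d₂ , d₃ , Nd) hb h≁u h′a₁ same valid un
    with Nbhd.joinᵃ Nv | Nbhd.joinᵇ Nv | Nbhd.joinᶜ Nv | Nbhd.joinᵈ Nv | Nbhd.joinᵇ Na | Nbhd.joinᵇ Nb | Nbhd.joinᵇ Nc
  ... | va , jva | vb , jvb | vc , jvc | vd , jvd | ua , jau | ub , jbu | uc , jcu =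
    let e , v′ , sub , col = extend-sequence (vd ∷ vc ∷ vb ∷ va ∷ []) valid unique
          (un (join-endˡ jvd) ∷ un (join-endˡ jvc) ∷ un (join-endˡ jvb) ∷ un (join-endˡ jva) ∷ [])
          ( (λ { _ _ (ud ∷ uc ∷ ub ∷ ua ∷ []) → free-pieces₆ (fourth Nv) Nd jvd ud
              (drop₁ a (join-endʳ jva) ∷ drop₁ b (join-endʳ jvb) ∷ drop₁ c (join-endʳ jvc) ∷ full d₁ ∷ full d₂ ∷ full d₃ ∷ [])
              refl ((inj₁ ua ∷ []) ∷ (inj₁ ub ∷ []) ∷ (inj₁ uc ∷ []) ∷ [] ∷ [] ∷ [] ∷ []) })
          -- Since `u` is a neighbor of `c`, the edges from `u` to `a` and `b` are counted at `u`
          -- and dropped at `a` and `b`.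
          , (λ { _ _ (uc ∷ ub ∷ ua ∷ []) → free-pieces₆ (third Nv) Nc jvc uc
              (drop₂ a (join-endʳ jva) (join-endˡ jau) (apart Na jva jau) ∷ drop₂ b (join-endʳ jvb) (join-endˡ jbu) (apart Nb jvb jbu)
                ∷ full d ∷ full u ∷ full c₁ ∷ full c₂ ∷ [])
              refl ((inj₁ ua ∷ inj₂ (_ , there (there (there (here (join-endʳ jau , λ ())))) , refl) ∷ []) ∷
                (inj₁ ub ∷ inj₂ (_ , there (there (there (here (join-endʳ jbu , λ ())))) , refl) ∷ []) ∷ [] ∷ [] ∷ [] ∷ [] ∷ []) })
          , (λ { _ _ (ub ∷ ua ∷ []) → free-pieces₆ (swap₁₂ Nv) Nb jvb ub
              (drop₂ a (join-endʳ jva) (join-endˡ jau) (apart Na jva jau) ∷ drop₁ c (join-endˡ jcu)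
                ∷ full d ∷ full u ∷ full b₁ ∷ full b₂ ∷ [])
              refl ((inj₁ ua ∷ inj₂ (_ , there (there (there (here (join-endʳ jau , λ ())))) , refl) ∷ []) ∷
                (inj₂ (_ , there (there (there (here (join-endʳ jcu , λ ())))) , refl) ∷ []) ∷ [] ∷ [] ∷ [] ∷ [] ∷ []) })
          , (λ { e sub (ua ∷ []) → free-pieces₆ Nv Na jva ua
              (drop₂ b (join-endˡ jbu) hb (λ { refl → h≁u (join-endʳ jbu) }) ∷ drop₁ c (join-endˡ jcu)
                ∷ full d ∷ full u ∷ full a₁ ∷ full a₂ ∷ [])
              refl ((inj₂ (_ , there (there (there (here (join-endʳ jbu , λ ())))) , refl) ∷
                  inj₂ (h′ , there (there (there (there (here (h′a₁ , λ ()))))) , same e sub) ∷ []) ∷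
                (inj₂ (_ , there (there (there (here (join-endʳ jcu , λ ())))) , refl) ∷ []) ∷ [] ∷ [] ∷ [] ∷ [] ∷ []) })
          , tt)
    in e , v′ , sub , λ p → col (listed p)
    where
    open Nbhd Nv hiding (joinᵃ; joinᵇ; joinᶜ; joinᵈ)

    apart : ∀ {x y z f g} → Nbhd x v u y z → Join f v x → Join g x u → f ≢ g
    apart N j j′ = join-≢ (join-sym j) j′ (Nbhd.a≢b N)

    unique : Unique (vd ∷ vc ∷ vb ∷ va ∷ [])
    unique = (join-≢ jvd jvc (c≢d ∘ sym) ∷ join-≢ jvd jvb (b≢d ∘ sym) ∷ join-≢ jvd jva (a≢d ∘ sym) ∷ [])
      ∷ (join-≢ jvc jvb (b≢c ∘ sym) ∷ join-≢ jvc jva (a≢c ∘ sym) ∷ []) ∷ (join-≢ jvb jva (a≢b ∘ sym) ∷ []) ∷ [] ∷ []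

    listed : ∀ {e} → IsEnd G e v → e ∈ vd ∷ vc ∷ vb ∷ va ∷ []
    listed p with cover p
    ... | inj₁ j = there (there (there (here (simple j jva))))
    ... | inj₂ (inj₁ j) = there (there (here (simple j jvb)))
    ... | inj₂ (inj₂ (inj₁ j)) = there (here (simple j jvc))
    ... | inj₂ (inj₂ (inj₂ j)) = here (simple j jvd)

  -- The edge `h` ends at `a₁` and at `b`, so it is itself the repetition.
  theta-shared-plan : ∀ {v u a b c d a₁ a₂ b₁ b₂ c₁ c₂ h} → Nbhd v a b c d → Nbhd a v u a₁ a₂ → Nbhd b v u b₁ b₂ →
    Nbhd c v u c₁ c₂ → Nbhd₁ d v → Join h a₁ b → u ≢ b → Plan v []
  theta-shared-plan {u = u} {h = h} Nv Na Nb Nc Nd j u≢b = unpainted-plan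
    (theta-finish Nv Na Nb Nc Nd (join-endʳ j) h≁u (join-endˡ j) (λ _ _ → refl))
    where
    h≁u : ¬ IsEnd G h u
    h≁u p with join-end j p
    ... | inj₁ a₁≡u = Nbhd.b≢c Na (sym a₁≡u)
    ... | inj₂ b≡u = u≢b (sym b≡u)

  same-color : ∀ {ps c e f g k} → AllPairs Compatible ps → paint ps ⊑ c → c ⊑ e → (f , k) ∈ ps → (g , k) ∈ ps → e f ≡ e g
  same-color comp sub sub′ p q = trans (sub′ (sub (paint⁺ comp p))) (sym (sub′ (sub (paint⁺ comp q))))

  -- The repetition is made by painting: `f` supplies the color at `a₁`, and `g` the same color at
  -- `b`.
  theta-pair-plan : ∀ {v u a b c d a₁ a₂ b₁ b₂ c₁ c₂ f g} → Nbhd v a b c d → Nbhd a v u a₁ a₂ → Nbhd b v u b₁ b₂ →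
    Nbhd c v u c₁ c₂ → Nbhd₁ d v → u ≢ b → Join f a a₁ → Join g b b₁ → ¬ Conflict G f g →
    Plan v ((f , zero) ∷ (g , zero) ∷ [])
  theta-pair-plan {v} {u} {a} {b} {a₁ = a₁} {b₁ = b₁} {f = f} {g} Nv Na Nb Nc Nd u≢b jf jg ¬con = record
    { compatible = comp
    ; nearby = λ { closed v∈ (here refl) → a , join-endˡ jf , closed (proj₂ joinᵃ) v∈
                 ; closed v∈ (there (here refl)) → b , join-endˡ jg , closed (proj₂ joinᵇ) v∈ }
    ; finish = λ {c} valid sub same → theta-finish Nv Na Nb Nc Nd (join-endˡ jg) g≁u (join-endʳ jf)
        (λ _ sub′ → same-color comp sub sub′ (there (here refl)) (here refl))
        valid (λ {e} p → trans (same p) (paint-nothing ps {e} λ { (here refl) → f≁v p ; (there (here refl)) → g≁v p }))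
    }
    where
    open Nbhd Nv
    ps : List (E × Color)
    ps = (f , zero) ∷ (g , zero) ∷ []

    comp : AllPairs Compatible ps
    comp = (nonconflict⇒compatible ¬con ∷ []) ∷ [] ∷ []

    f≁v : ¬ IsEnd G f v
    f≁v p with join-end jf p
    ... | inj₁ refl = loopless (proj₂ joinᵃ)
    ... | inj₂ a₁≡v = Nbhd.a≢c Na (sym a₁≡v)

    g≁v : ¬ IsEnd G g v
    g≁v p with join-end jg p
    ... | inj₁ refl = loopless (proj₂ joinᵇ)
    ... | inj₂ b₁≡v = Nbhd.a≢c Nb (sym b₁≡v)

    g≁u : ¬ IsEnd G g u
    g≁u p with join-end jg p
    ... | inj₁ b≡u = u≢b (sym b≡u)
    ... | inj₂ b₁≡u = Nbhd.b≢c Nb (sym b₁≡u)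

  -- The counts are 21, 20 and 21. They drop uncolored edges at `x₁`, cycle edges that are kept at
  -- `x₃`, and one edge of a precolored pair where the other is kept: `e₃` because of `e₁` at `y₁`,
  -- and `e₂` or `e₄` because of the other at `x₄` or `x₂`.
  four-cycle-plan : ∀ {x₁ x₂ x₃ x₄ y₁ y₂ y₃ y₄ z₁ z₂ z₃ z₄ e₁ e₂ e₃ e₄} →
    Nbhd x₁ x₂ x₄ y₁ z₁ → Nbhd x₂ x₁ x₃ y₂ z₂ → Nbhd x₃ x₂ x₄ y₃ z₃ → Nbhd x₄ x₁ x₃ y₄ z₄ → Nbhd₁ z₁ x₁ →
    Join e₁ x₁ y₁ → Join e₂ x₂ y₂ → Join e₃ x₃ y₃ → Join e₄ x₄ y₄ →
    AllPairs Compatible ((e₁ , zero) ∷ (e₃ , zero) ∷ (e₂ , suc zero) ∷ (e₄ , suc zero) ∷ []) →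
    Plan x₁ ((e₁ , zero) ∷ (e₃ , zero) ∷ (e₂ , suc zero) ∷ (e₄ , suc zero) ∷ [])
  four-cycle-plan {x₁} {x₂} {x₃} {x₄} {y₁} {y₂} {y₃} {y₄} {z₁} {z₂} {z₃} {z₄} {e₁} {e₂} {e₃} {e₄}
    N₁ N₂ N₃ N₄ (q₁ , q₂ , q₃ , Nq) j₁ j₂ j₃ j₄ comp
    with Nbhd.joinᵃ N₁ | Nbhd.joinᵇ N₁ | Nbhd.joinᵈ N₁ | Nbhd.joinᵇ N₂ | Nbhd.joinᵇ N₄
  ... | e₁₂ , j₁₂ | e₁₄ , j₁₄ | e₁z , j₁z | e₂₃ , j₂₃ | e₄₃ , j₄₃ = record
    { compatible = comp
    ; nearby = λ { closed x₁∈ (here refl) → x₁ , join-endˡ j₁ , x₁∈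
                 ; closed x₁∈ (there (here refl)) → x₃ , join-endˡ j₃ , closed j₂₃ (closed j₁₂ x₁∈)
                 ; closed x₁∈ (there (there (here refl))) → x₂ , join-endˡ j₂ , closed j₁₂ x₁∈
                 ; closed x₁∈ (there (there (there (here refl)))) → x₄ , join-endˡ j₄ , closed j₁₄ x₁∈ }
    ; finish = finish
    }
    where
    open Nbhd N₁ hiding (joinᵃ; joinᵇ; joinᶜ; joinᵈ)
    ps : List (E × Color)
    ps = (e₁ , zero) ∷ (e₃ , zero) ∷ (e₂ , suc zero) ∷ (e₄ , suc zero) ∷ []

    -- The precolored edges form a matching, and `e₁` is the one at `x₁`.
    unpainted : ∀ {e} → IsEnd G e x₁ → e ≢ e₁ → paint ps e ≡ nothing
    unpainted {e} p e≢e₁ with colored? (paint ps) e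
    ... | inj₁ col = contradiction (paint-matching comp p (join-endˡ j₁) col (zero , paint⁺ comp (here refl))) e≢e₁
    ... | inj₂ un = un

    unique : Unique (e₁z ∷ e₁₄ ∷ e₁₂ ∷ [])
    unique = (join-≢ j₁z j₁₄ (b≢d ∘ sym) ∷ join-≢ j₁z j₁₂ (a≢d ∘ sym) ∷ []) ∷ (join-≢ j₁₄ j₁₂ (a≢b ∘ sym) ∷ []) ∷ [] ∷ []

    finish : ∀ {c} → Valid c → paint ps ⊑ c → (∀ {e} → IsEnd G e x₁ → c e ≡ paint ps e) → Finish x₁ c
    finish {c} valid sub same =
      let e , v′ , sub′ , col = extend-sequence (e₁z ∷ e₁₄ ∷ e₁₂ ∷ []) valid unique
            (un j₁z (c≢d ∘ sym) ∷ un j₁₄ b≢c ∷ un j₁₂ a≢c ∷ [])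
            ( (λ { e sub′ (uz ∷ u₄ ∷ u₂ ∷ []) → free-pieces₆ (fourth N₁) Nq j₁z uz
                (drop₂ x₂ (join-endʳ j₁₂) (join-endˡ j₂) (join-≢ (join-sym j₁₂) j₂ (Nbhd.a≢c N₂)) ∷ drop₁ x₄ (join-endʳ j₁₄)
                  ∷ full y₁ ∷ full q₁ ∷ full q₂ ∷ full q₃ ∷ [])
                refl ((inj₁ u₂ ∷ inj₂ (e₄ , there (here (join-endˡ j₄ ,
                    λ { (here r) → join-≢ (join-sym j₁₄) j₄ (Nbhd.a≢c N₄) (sym r) })) , same₂₄ sub′) ∷ []) ∷
                  (inj₁ u₄ ∷ []) ∷ [] ∷ [] ∷ [] ∷ [] ∷ []) })
            , (λ { e sub′ (u₄ ∷ u₂ ∷ []) → free-pieces₆ (swap₁₂ N₁) N₄ j₁₄ u₄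
                (drop₂ x₂ (join-endʳ j₁₂) (join-endˡ j₂₃) (join-≢ (join-sym j₁₂) j₂₃ (Nbhd.a≢b N₂)) ∷ full y₁ ∷ full z₁
                  ∷ drop₁ x₃ (join-endˡ j₃) ∷ drop₁ y₄ (join-endʳ j₄) ∷ full z₄ ∷ [])
                refl ((inj₁ u₂ ∷ inj₂ (e₂₃ , there (there (there (here (join-endʳ j₂₃ ,
                    λ { (here r) → join-≢ (join-sym j₂₃) j₃ (Nbhd.a≢c N₃) r })))) , refl) ∷ []) ∷ [] ∷ [] ∷
                  (inj₂ (e₁ , there (here (join-endʳ j₁ , λ ())) , sym (same₁₃ sub′)) ∷ []) ∷
                  (inj₂ (e₂ , here (join-endˡ j₂ , (λ { (here r) → join-≢ (join-sym j₁₂) j₂ (Nbhd.a≢c N₂) (sym r)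
                    ; (there (here r)) → join-≢ j₂₃ j₂ (Nbhd.b≢c N₂) (sym r) })) , sym (same₂₄ sub′)) ∷ []) ∷ [] ∷ []) })
            , (λ { e sub′ (u₂ ∷ []) → free-pieces₆ N₁ N₂ j₁₂ u₂
                (drop₁ x₄ (join-endˡ j₄₃) ∷ full y₁ ∷ full z₁
                  ∷ drop₁ x₃ (join-endˡ j₃) ∷ drop₁ y₂ (join-endʳ j₂) ∷ full z₂ ∷ [])
                refl ((inj₂ (e₄₃ , there (there (there (here (join-endʳ j₄₃ ,
                    λ { (here r) → join-≢ (join-sym j₄₃) j₃ (Nbhd.b≢c N₃) r })))) , refl) ∷ []) ∷ [] ∷ [] ∷
                  (inj₂ (e₁ , there (here (join-endʳ j₁ , λ ())) , sym (same₁₃ sub′)) ∷ []) ∷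
                  (inj₂ (e₄ , here (join-endˡ j₄ , (λ { (here r) → join-≢ j₄₃ j₄ (Nbhd.b≢c N₄) (sym r) })) , same₂₄ sub′) ∷ []) ∷
                  [] ∷ []) })
            , tt)
      in e , v′ , sub′ , λ p → done sub′ col p
      where
      un : ∀ {e z} → Join e x₁ z → z ≢ y₁ → c e ≡ nothing
      un j z≢y₁ = trans (same (join-endˡ j)) (unpainted (join-endˡ j) (join-≢ j j₁ z≢y₁))

      same₁₃ : ∀ {e} → c ⊑ e → e e₁ ≡ e e₃
      same₁₃ sub′ = same-color comp sub sub′ (here refl) (there (here refl))

      same₂₄ : ∀ {e} → c ⊑ e → e e₂ ≡ e e₄
      same₂₄ sub′ = same-color comp sub sub′ (there (there (here refl))) (there (there (there (here refl))))

      done : ∀ {e f} → c ⊑ e → (∀ {f} → f ∈ e₁z ∷ e₁₄ ∷ e₁₂ ∷ [] → Colored e f) → IsEnd G f x₁ → Colored e f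
      done {e} sub′ col p with cover p
      ... | inj₁ j = col (there (there (here (simple j j₁₂))))
      ... | inj₂ (inj₁ j) = col (there (here (simple j j₁₄)))
      -- The edge to `y₁` is `e₁`, which was colored in advance and is not in the sequence.
      ... | inj₂ (inj₂ (inj₁ j)) = subst (Colored e) (simple j₁ j) (zero , sub′ (sub (paint⁺ comp (here refl))))
      ... | inj₂ (inj₂ (inj₂ j)) = col (here (simple j j₁z))

  -- The color of `f₁` shows at `v₂`, `v₃` and `v₄` as well as at `w₁`; counting it only at `w₁`
  -- leaves 24 - 3 = 21.
  tree-free : ∀ {d v v₁ v₂ v₃ v₄ w₁ e f₁ f₂ f₃ f₄} → Nbhd v v₁ v₂ v₃ v₄ → Nbhd₂ v₁ v w₁ → Join e v v₁ → d e ≡ nothing →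
    IsEnd G f₁ w₁ → IsEnd G f₂ v₂ → IsEnd G f₃ v₃ → IsEnd G f₄ v₄ → d f₂ ≡ d f₁ → d f₃ ≡ d f₁ → d f₄ ≡ d f₁ →
    ∃ (Free d e)
  tree-free {v₂ = v₂} {v₃} {v₄} {w₁} {f₁ = f₁} Nv (s , t , N₁) j un p₁ p₂ p₃ p₄ c₂ c₃ c₄ = free-pieces₆ Nv N₁ j un
    (drop₁ v₂ p₂ ∷ drop₁ v₃ p₃ ∷ drop₁ v₄ p₄ ∷ full w₁ ∷ full s ∷ full t ∷ [])
    refl ((inj₂ (f₁ , at-w₁ , c₂) ∷ []) ∷ (inj₂ (f₁ , at-w₁ , c₃) ∷ []) ∷ (inj₂ (f₁ , at-w₁ , c₄) ∷ []) ∷ [] ∷ [] ∷ [] ∷ [])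
    where
    at-w₁ : Kept (drop₁ v₂ p₂ ∷ drop₁ v₃ p₃ ∷ drop₁ v₄ p₄ ∷ full w₁ ∷ full s ∷ full t ∷ []) f₁
    at-w₁ = there (there (there (here (p₁ , λ ()))))

  tree-plan : ∀ {v v₁ v₂ v₃ v₄ w₁ w₂ w₃ w₄ f₁ f₂ f₃ f₄} → Nbhd v v₁ v₂ v₃ v₄ →
    Nbhd₂ v₁ v w₁ → Nbhd₂ v₂ v w₂ → Nbhd₂ v₃ v w₃ → Nbhd₂ v₄ v w₄ →
    Join f₁ v₁ w₁ → Join f₂ v₂ w₂ → Join f₃ v₃ w₃ → Join f₄ v₄ w₄ →
    AllPairs (λ f g → ¬ Conflict G f g) (f₁ ∷ f₂ ∷ f₃ ∷ f₄ ∷ []) →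
    Plan v (map (_, zero) (f₁ ∷ f₂ ∷ f₃ ∷ f₄ ∷ []))
  tree-plan {v} {v₁} {v₂} {v₃} {v₄} {w₁} {w₂} {w₃} {w₄} {f₁} {f₂} {f₃} {f₄} Nv N₁ N₂ N₃ N₄ k₁ k₂ k₃ k₄ apart
    with Nbhd.joinᵃ Nv | Nbhd.joinᵇ Nv | Nbhd.joinᶜ Nv | Nbhd.joinᵈ Nv
  ... | e₁ , j₁ | e₂ , j₂ | e₃ , j₃ | e₄ , j₄ = record
    { compatible = comp
    ; nearby = λ { closed v∈ (here refl) → v₁ , join-endˡ k₁ , closed j₁ v∈
                 ; closed v∈ (there (here refl)) → v₂ , join-endˡ k₂ , closed j₂ v∈
                 ; closed v∈ (there (there (here refl))) → v₃ , join-endˡ k₃ , closed j₃ v∈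
                 ; closed v∈ (there (there (there (here refl)))) → v₄ , join-endˡ k₄ , closed j₄ v∈ }
    ; finish = finish
    }
    where
    open Nbhd Nv hiding (joinᵃ; joinᵇ; joinᶜ; joinᵈ)
    ps : List (E × Color)
    ps = map (_, zero) (f₁ ∷ f₂ ∷ f₃ ∷ f₄ ∷ [])

    comp : AllPairs Compatible ps
    comp = AllPairs.map⁺ (AllPairs.map nonconflict⇒compatible apart)

    away : ∀ {f z w} → Nbhd₂ z v w → Join f z w → ¬ IsEnd G f v
    away (_ , _ , N) k p with join-end k p
    ... | inj₁ refl = Nbhd.loopless N (proj₂ (Nbhd.joinᵃ N))
    ... | inj₂ w≡v = Nbhd.a≢b N (sym w≡v)

    unpainted : ∀ {e} → IsEnd G e v → paint ps e ≡ nothing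
    unpainted {e} p = paint-nothing ps {e} λ
      { (here refl) → away N₁ k₁ p ; (there (here refl)) → away N₂ k₂ p
      ; (there (there (here refl))) → away N₃ k₃ p ; (there (there (there (here refl)))) → away N₄ k₄ p }

    unique : Unique (e₁ ∷ e₂ ∷ e₃ ∷ e₄ ∷ [])
    unique = (join-≢ j₁ j₂ a≢b ∷ join-≢ j₁ j₃ a≢c ∷ join-≢ j₁ j₄ a≢d ∷ [])
      ∷ (join-≢ j₂ j₃ b≢c ∷ join-≢ j₂ j₄ b≢d ∷ []) ∷ (join-≢ j₃ j₄ c≢d ∷ []) ∷ [] ∷ []

    listed : ∀ {e} → IsEnd G e v → e ∈ e₁ ∷ e₂ ∷ e₃ ∷ e₄ ∷ []
    listed p with cover p
    ... | inj₁ j = here (simple j j₁)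
    ... | inj₂ (inj₁ j) = there (here (simple j j₂))
    ... | inj₂ (inj₂ (inj₁ j)) = there (there (here (simple j j₃)))
    ... | inj₂ (inj₂ (inj₂ j)) = there (there (there (here (simple j j₄))))

    finish : ∀ {c} → Valid c → paint ps ⊑ c → (∀ {e} → IsEnd G e v → c e ≡ paint ps e) → Finish v c
    finish {c} valid sub same =
      let e , v′ , sub′ , col = extend-sequence (e₁ ∷ e₂ ∷ e₃ ∷ e₄ ∷ []) valid unique
            (un j₁ ∷ un j₂ ∷ un j₃ ∷ un j₄ ∷ [])
            ( (λ { e sub′ (u ∷ _) → tree-free Nv N₁ j₁ u (join-endʳ k₁) (join-endˡ k₂) (join-endˡ k₃) (join-endˡ k₄)
                (one sub′ f₂∈ f₁∈) (one sub′ f₃∈ f₁∈) (one sub′ f₄∈ f₁∈) })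
            , (λ { e sub′ (u ∷ _) → tree-free (swap₁₂ Nv) N₂ j₂ u (join-endʳ k₂) (join-endˡ k₁) (join-endˡ k₃) (join-endˡ k₄)
                (one sub′ f₁∈ f₂∈) (one sub′ f₃∈ f₂∈) (one sub′ f₄∈ f₂∈) })
            , (λ { e sub′ (u ∷ _) → tree-free (third Nv) N₃ j₃ u (join-endʳ k₃) (join-endˡ k₁) (join-endˡ k₂) (join-endˡ k₄)
                (one sub′ f₁∈ f₃∈) (one sub′ f₂∈ f₃∈) (one sub′ f₄∈ f₃∈) })
            , (λ { e sub′ (u ∷ _) → tree-free (fourth Nv) N₄ j₄ u (join-endʳ k₄) (join-endˡ k₁) (join-endˡ k₂) (join-endˡ k₃)
                (one sub′ f₁∈ f₄∈) (one sub′ f₂∈ f₄∈) (one sub′ f₃∈ f₄∈) })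
            , tt)
      in e , v′ , sub′ , λ p → col (listed p)
      where
      un : ∀ {e z} → Join e v z → c e ≡ nothing
      un j = trans (same (join-endˡ j)) (unpainted (join-endˡ j))

      one : ∀ {e f g} → c ⊑ e → f ∈ f₁ ∷ f₂ ∷ f₃ ∷ f₄ ∷ [] → g ∈ f₁ ∷ f₂ ∷ f₃ ∷ f₄ ∷ [] → e f ≡ e g
      one sub′ p q = same-color comp sub sub′ (∈-map⁺ (_, zero) p) (∈-map⁺ (_, zero) q)

      f₁∈ : f₁ ∈ f₁ ∷ f₂ ∷ f₃ ∷ f₄ ∷ []
      f₁∈ = here refl
      f₂∈ : f₂ ∈ f₁ ∷ f₂ ∷ f₃ ∷ f₄ ∷ []
      f₂∈ = there (here refl)
      f₃∈ : f₃ ∈ f₁ ∷ f₂ ∷ f₃ ∷ f₄ ∷ []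
      f₃∈ = there (there (here refl))
      f₄∈ : f₄ ∈ f₁ ∷ f₂ ∷ f₃ ∷ f₄ ∷ []
      f₄∈ = there (there (there (here refl)))

  -- Choosing a configuration

  module Choice {S : List V} (closed : Closed S) where

    -- As `S` is closed, the other end lies outside `S` too. Adjacency is thus confined to the
    -- components that `S` does not meet.
    Adj : V → V → Set
    Adj x y = x ∉ S × ∃[ g ] Join g x y

    adj? : ∀ x y → Dec (Adj x y)
    adj? x y = ¬? (_∈?_ _≟_ x S) ×-dec any? (λ g → join? g x y)

    adj-sym : ∀ {x y} → Adj x y → Adj y x
    adj-sym (x∉ , g , j) = (λ y∈ → x∉ (closed (join-sym j) y∈)) , g , join-sym j

    adj-join : ∀ {x y z g} → Adj x y → Join g y z → Adj y z
    adj-join xy j = proj₁ (adj-sym xy) , _ , j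

    Planned : Set
    Planned = ∃[ w ] w ∉ S × ∃[ ps ] Plan w ps

    module _ (nbhd : ∀ x → x ∉ S → ∃[ a ] Nbhd₁ x a) where

      adj-≢ : ∀ {x y} → Adj x y → x ≢ y
      adj-≢ (x∉ , g , j) refl = let _ , _ , _ , _ , N = nbhd _ x∉ in Nbhd.loopless N j

      nbhd₁ : ∀ {x y} → Adj x y → Nbhd₁ x y
      nbhd₁ (x∉ , g , j) = let _ , _ , _ , _ , N = nbhd _ x∉ in pivot₁ N j

      nbhd₂ : ∀ {x y z} → Adj x y → Adj x z → y ≢ z → Nbhd₂ x y z
      nbhd₂ xy (_ , _ , j) y≢z = let _ , _ , _ , N = nbhd₁ xy in pivot₂ N j (y≢z ∘ sym)

      nbhd₃ : ∀ {x y z w} → Adj x y → Adj x z → Adj x w → y ≢ z → y ≢ w → z ≢ w → Nbhd₃ x y z w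
      nbhd₃ xy xz (_ , _ , j) y≢z y≢w z≢w = let _ , _ , N = nbhd₂ xy xz y≢z in pivot₃ N j (y≢w ∘ sym) (z≢w ∘ sym)

      triangle-case : ∀ {x y z} → Adj x y → Adj x z → Adj y z → Planned
      triangle-case xy xz yz =
        let c , d , N = nbhd₂ xy xz (adj-≢ yz)
            yx = adj-sym xy
            zx = adj-sym xz
        in _ , proj₁ xy , [] , triangle-plan N (nbhd₂ yx yz (adj-≢ xz)) (nbhd₂ zx (adj-sym yz) (adj-≢ xy))
          (nbhd₁ (adj-sym (proj₁ xy , Nbhd.joinᶜ N))) (nbhd₁ (adj-sym (proj₁ xy , Nbhd.joinᵈ N)))

      -- Three common neighbors in the absence of triangles

      module _ (no-triangle : ∀ {x y z} → Adj x y → Adj x z → ¬ Adj y z) where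

        -- Two neighbors of `v` are not adjacent, as there are no triangles. A conflict could
        -- therefore only come from an adjacency between `a` and `y`, `x` and `b`, or `a` and `b`; a
        -- common end would yield one of these or a triangle.
        nonconflicting : ∀ {v x y a b f g} → Adj v x → Adj v y → x ≢ y → Join f x a → Join g y b →
          ¬ Adj y a → ¬ Adj x b → ¬ Adj a b → ¬ Conflict G f g
        nonconflicting {v} {x} {y} {a} {b} vx vy x≢y jf jg y≁a x≁b a≁b = λ
          { (inj₁ (z , p , q)) → share (join-end jf p) (join-end jg q)
          ; (inj₂ (h , z , w , p , q , jh)) → link (join-end jf p) (join-end jg q) jh }
          where
          xa : Adj x a
          xa = adj-join vx jf
          yb : Adj y b
          yb = adj-join vy jg

          share : ∀ {z} → x ≡ z ⊎ a ≡ z → y ≡ z ⊎ b ≡ z → ⊥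
          share (inj₁ refl) (inj₁ refl) = x≢y refl
          share (inj₁ refl) (inj₂ refl) = no-triangle vy vx yb
          share (inj₂ refl) (inj₁ refl) = no-triangle vx vy xa
          share (inj₂ refl) (inj₂ refl) = x≁b xa

          link : ∀ {h z w} → x ≡ z ⊎ a ≡ z → y ≡ w ⊎ b ≡ w → Join h z w → ⊥
          link (inj₁ refl) (inj₁ refl) jh = no-triangle vx vy (adj-join vx jh)
          link (inj₁ refl) (inj₂ refl) jh = x≁b (adj-join vx jh)
          link (inj₂ refl) (inj₁ refl) jh = y≁a (adj-sym (adj-join xa jh))
          link (inj₂ refl) (inj₂ refl) jh = a≁b (adj-join xa jh)

        -- First come eight tests for a third common neighbor of two of `a`, `b`, `c`. If all fail,
        -- the edge from `a` to `a₁` is tried against the edges from `b` and `c` to `b₁`, `b₂`,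
        -- `c₁`, `c₂`, and any far end not adjacent to `a₁` gives a pair that can be colored alike.
        theta-case : ∀ {v u a b c} → v ≢ u → Adj v a → Adj v b → Adj v c → Adj u a → Adj u b → Adj u c →
          a ≢ b → a ≢ c → b ≢ c → Planned
        theta-case {v} {u} {a} {b} {c} v≢u va vb vc ua ub uc a≢b a≢c b≢c
          with nbhd₃ va vb vc a≢b a≢c b≢c
            | nbhd₂ (adj-sym va) (adj-sym ua) v≢u | nbhd₂ (adj-sym vb) (adj-sym ub) v≢u | nbhd₂ (adj-sym vc) (adj-sym uc) v≢u
        ... | d , Nv | a₁ , a₂ , Na | b₁ , b₂ , Nb | c₁ , c₂ , Nc =
          [ (λ (_ , _ , j) → shared Nv Na Nb Nc ub j)
          , (λ a₁≁b → [ (λ (_ , _ , j) → shared (swap₂₃ Nv) Na Nc Nb uc j)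
          , (λ a₁≁c → [ (λ (_ , _ , j) → shared (swap₁₂ Nv) Nb Na Nc ua j)
          , (λ b₁≁a → [ (λ (_ , _ , j) → shared (swap₁₂ Nv) (swap₃₄ Nb) Na Nc ua j)
          , (λ b₂≁a → [ (λ (_ , _ , j) → shared (third Nv) Nc Na Nb ua j)
          , (λ c₁≁a → [ (λ (_ , _ , j) → shared (third Nv) (swap₃₄ Nc) Na Nb ua j)
          , (λ c₂≁a → [ (λ (_ , _ , j) → shared (swap₂₃ (swap₁₂ Nv)) Nb Nc Na uc j)
          , (λ b₁≁c → [ (λ (_ , _ , j) → shared (swap₂₃ (swap₁₂ Nv)) (swap₃₄ Nb) Nc Na uc j)
          , (λ b₂≁c → [ (λ a₁b₁ → [ (λ a₁b₂ → [ (λ a₁c₁ → [ (λ a₁c₂ →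
                ⊥-elim (crowded a₁b₁ a₁b₂ a₁c₁ a₁c₂ b₁≁c b₂≁c))
          , (λ a₁≁c₂ → pair (swap₂₃ Nv) Na (swap₃₄ Nc) Nb va vc uc a≢c (a₁≁c ∘ adj-sym) (c₂≁a ∘ adj-sym) a₁≁c₂) ]′ (decide (adj? a₁ c₂)))
          , (λ a₁≁c₁ → pair (swap₂₃ Nv) Na Nc Nb va vc uc a≢c (a₁≁c ∘ adj-sym) (c₁≁a ∘ adj-sym) a₁≁c₁) ]′ (decide (adj? a₁ c₁)))
          , (λ a₁≁b₂ → pair Nv Na (swap₃₄ Nb) Nc va vb ub a≢b (a₁≁b ∘ adj-sym) (b₂≁a ∘ adj-sym) a₁≁b₂) ]′ (decide (adj? a₁ b₂)))
          , (λ a₁≁b₁ → pair Nv Na Nb Nc va vb ub a≢b (a₁≁b ∘ adj-sym) (b₁≁a ∘ adj-sym) a₁≁b₁) ]′ (decide (adj? a₁ b₁)))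
          ]′ (decide (adj? b₂ c))) ]′ (decide (adj? b₁ c))) ]′ (decide (adj? c₂ a))) ]′ (decide (adj? c₁ a)))
          ]′ (decide (adj? b₂ a))) ]′ (decide (adj? b₁ a))) ]′ (decide (adj? a₁ c))) ]′ (decide (adj? a₁ b))
          where
          v∉ : v ∉ S
          v∉ = proj₁ va

          aa₁ : Adj a a₁
          aa₁ = proj₁ (adj-sym va) , Nbhd.joinᶜ Na

          Nd : Nbhd₁ d v
          Nd = nbhd₁ (adj-sym (v∉ , Nbhd.joinᵈ Nv))

          shared : ∀ {a b c a₁ a₂ b₁ b₂ c₁ c₂ h} → Nbhd v a b c d → Nbhd a v u a₁ a₂ → Nbhd b v u b₁ b₂ →
            Nbhd c v u c₁ c₂ → Adj u b → Join h a₁ b → Planned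
          shared Nv Na Nb Nc ub j = v , v∉ , _ , theta-shared-plan Nv Na Nb Nc Nd j (adj-≢ ub)

          pair : ∀ {a b c a₁ a₂ b₁ b₂ c₁ c₂} → Nbhd v a b c d → Nbhd a v u a₁ a₂ → Nbhd b v u b₁ b₂ →
            Nbhd c v u c₁ c₂ → Adj v a → Adj v b → Adj u b → a ≢ b → ¬ Adj b a₁ → ¬ Adj a b₁ → ¬ Adj a₁ b₁ → Planned
          pair Nv Na Nb Nc va vb ub a≢b b≁a₁ a≁b₁ a₁≁b₁ =
            let _ , jf = Nbhd.joinᶜ Na
                _ , jg = Nbhd.joinᶜ Nb
            in v , v∉ , _ , theta-pair-plan Nv Na Nb Nc Nd (adj-≢ ub) jf jg
              (nonconflicting va vb a≢b jf jg b≁a₁ a≁b₁ a₁≁b₁)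

          -- Otherwise a₁ has the five neighbors a, b₁, b₂, c₁, c₂.
          crowded : Adj a₁ b₁ → Adj a₁ b₂ → Adj a₁ c₁ → Adj a₁ c₂ → ¬ Adj b₁ c → ¬ Adj b₂ c → ⊥
          crowded (_ , g₁ , j₁) (_ , g₂ , j₂) (_ , h₁ , k₁) (_ , h₂ , k₂) b₁≁c b₂≁c =
            <⇒≱ (ℕ.s≤s ≤-refl) (length-distinct {a₁} {g₀ ∷ g₁ ∷ g₂ ∷ h₁ ∷ h₂ ∷ []} unique at)
            where
            g₀ : E
            g₀ = proj₁ (proj₂ (adj-sym aa₁))
            j₀ : Join g₀ a₁ a
            j₀ = proj₂ (proj₂ (adj-sym aa₁))

            bb : ∀ {x} → ∃[ g ] Join g b x → Adj b x
            bb (g , j) = adj-join vb j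
            cc : ∀ {x} → ∃[ g ] Join g c x → Adj c x
            cc (g , j) = adj-join vc j

            bb₁ : Adj b b₁
            bb₁ = bb (Nbhd.joinᶜ Nb)
            bb₂ : Adj b b₂
            bb₂ = bb (Nbhd.joinᵈ Nb)
            cc₁ : Adj c c₁
            cc₁ = cc (Nbhd.joinᶜ Nc)
            cc₂ : Adj c c₂
            cc₂ = cc (Nbhd.joinᵈ Nc)

            a≢ : ∀ {x y} → Adj v x → Adj x y → a ≢ y
            a≢ vx xy refl = no-triangle vx va xy

            sep : ∀ {x y} → ¬ Adj x c → Adj c y → x ≢ y
            sep x≁c cy refl = x≁c (adj-sym cy)

            unique : Unique (g₀ ∷ g₁ ∷ g₂ ∷ h₁ ∷ h₂ ∷ [])
            unique = (join-≢ j₀ j₁ (a≢ vb bb₁) ∷ join-≢ j₀ j₂ (a≢ vb bb₂) ∷ join-≢ j₀ k₁ (a≢ vc cc₁) ∷ join-≢ j₀ k₂ (a≢ vc cc₂) ∷ [])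
              ∷ (join-≢ j₁ j₂ (Nbhd.c≢d Nb) ∷ join-≢ j₁ k₁ (sep b₁≁c cc₁) ∷ join-≢ j₁ k₂ (sep b₁≁c cc₂) ∷ [])
              ∷ (join-≢ j₂ k₁ (sep b₂≁c cc₁) ∷ join-≢ j₂ k₂ (sep b₂≁c cc₂) ∷ [])
              ∷ (join-≢ k₁ k₂ (Nbhd.c≢d Nc) ∷ []) ∷ [] ∷ []

            at : ∀ {h} → h ∈ g₀ ∷ g₁ ∷ g₂ ∷ h₁ ∷ h₂ ∷ [] → IsEnd G h a₁
            at (here refl) = join-endˡ j₀
            at (there (here refl)) = join-endˡ j₁
            at (there (there (here refl))) = join-endˡ j₂
            at (there (there (there (here refl)))) = join-endˡ k₁
            at (there (there (there (there (here refl))))) = join-endˡ k₂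

        -- Cycles of length four

        module _ (no-theta : ∀ {v u a b c} → v ≢ u → Adj v a → Adj v b → Adj v c → Adj u a → Adj u b → Adj u c →
          a ≢ b → a ≢ c → b ≢ c → ⊥) where

          -- A common far end would close a triangle on the adjacent vertices `x` and `y`.
          disjoint-adjacent : ∀ {x y a b f g} → Adj x y → Join f x a → Join g y b → y ≢ a → x ≢ b → Disjoint f g
          disjoint-adjacent xy jf jg y≢a x≢b p q with join-end jf p | join-end jg q
          ... | inj₁ refl | inj₁ refl = adj-≢ xy refl
          ... | inj₁ refl | inj₂ refl = x≢b refl
          ... | inj₂ refl | inj₁ refl = y≢a refl
          ... | inj₂ refl | inj₂ refl = no-triangle xy (proj₁ xy , _ , jf) (adj-join xy jg)

          -- If all four pairs conflicted, then p and q would have the common neighbors x, r, s.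
          opposite-pair : ∀ {x y a b} → x ≢ y → a ≢ b → Adj x a → Adj x b → Adj y a → Adj y b →
            ∃[ p ] ∃[ q ] ∃[ r ] ∃[ s ] Nbhd x a b p q × Nbhd y a b r s ×
              ∃[ f ] ∃[ g ] Join f x p × Join g y r × ¬ Conflict G f g
          opposite-pair {x} {y} {a} {b} x≢y a≢b xa xb ya yb with nbhd₂ xa xb a≢b | nbhd₂ ya yb a≢b
          ... | p , q , N | r , s , M =
            [ (λ pr → [ (λ ps → [ (λ qr → [ (λ qs → ⊥-elim (no-theta (Nbhd.c≢d N) (adj-sym xp) pr ps (adj-sym xq) qr qs
                  (x≢ yr) (x≢ ys) (Nbhd.c≢d M)))
            , choose (swap₃₄ N) (swap₃₄ M) ]′ (decide (adj? q s)))
            , choose (swap₃₄ N) M ]′ (decide (adj? q r)))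
            , choose N (swap₃₄ M) ]′ (decide (adj? p s)))
            , choose N M ]′ (decide (adj? p r))
            where
            xp : Adj x p
            xp = proj₁ xa , Nbhd.joinᶜ N
            xq : Adj x q
            xq = proj₁ xa , Nbhd.joinᵈ N
            yr : Adj y r
            yr = proj₁ ya , Nbhd.joinᶜ M
            ys : Adj y s
            ys = proj₁ ya , Nbhd.joinᵈ M

            x≢ : ∀ {z} → Adj y z → x ≢ z
            x≢ yz refl = no-triangle yz ya xa

            choose : ∀ {p q r s} → Nbhd x a b p q → Nbhd y a b r s → ¬ Adj p r →
              ∃[ p ] ∃[ q ] ∃[ r ] ∃[ s ] Nbhd x a b p q × Nbhd y a b r s ×
              ∃[ f ] ∃[ g ] Join f x p × Join g y r × ¬ Conflict G f g
            choose N M p≁r =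
              let f , jf = Nbhd.joinᶜ N
                  g , jg = Nbhd.joinᶜ M
                  xp = proj₁ xa , f , jf
                  yr = proj₁ ya , g , jg
              in _ , _ , _ , _ , N , M , f , g , jf , jg , nonconflicting (adj-sym xa) (adj-sym ya) x≢y jf jg
                (λ yp → no-theta x≢y xa xb xp ya yb yp a≢b (Nbhd.a≢c N) (Nbhd.b≢c N))
                (λ xr → no-theta x≢y xa xb xr ya yb yr a≢b (Nbhd.a≢c M) (Nbhd.b≢c M)) p≁r

          four-cycle-case : ∀ {x₁ x₂ x₃ x₄} → x₁ ≢ x₃ → x₂ ≢ x₄ → Adj x₁ x₂ → Adj x₁ x₄ → Adj x₃ x₂ → Adj x₃ x₄ → Planned
          four-cycle-case x₁≢x₃ x₂≢x₄ a₁₂ a₁₄ a₃₂ a₃₄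
            with opposite-pair x₁≢x₃ x₂≢x₄ a₁₂ a₁₄ a₃₂ a₃₄
              | opposite-pair x₂≢x₄ x₁≢x₃ (adj-sym a₁₂) (adj-sym a₃₂) (adj-sym a₁₄) (adj-sym a₃₄)
          ... | _ , _ , _ , _ , N₁ , N₃ , _ , _ , j₁ , j₃ , ¬con₁₃ | _ , _ , _ , _ , N₂ , N₄ , _ , _ , j₂ , j₄ , ¬con₂₄ =
            _ , proj₁ a₁₂ , _ ,
            four-cycle-plan N₁ N₂ N₃ N₄ (nbhd₁ (adj-sym (proj₁ a₁₂ , Nbhd.joinᵈ N₁))) j₁ j₂ j₃ j₄
              -- Edges of different pairs have different colors, so for them disjointness suffices.
              ( (nonconflict⇒compatible ¬con₁₃
                ∷ (disjoint-adjacent a₁₂ j₁ j₂ (Nbhd.a≢c N₁) (Nbhd.a≢c N₂) , λ ())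
                ∷ (disjoint-adjacent a₁₄ j₁ j₄ (Nbhd.b≢c N₁) (Nbhd.a≢c N₄) , λ ()) ∷ [])
              ∷ ((disjoint-adjacent a₃₂ j₃ j₂ (Nbhd.a≢c N₃) (Nbhd.b≢c N₂) , λ ())
                ∷ (disjoint-adjacent a₃₄ j₃ j₄ (Nbhd.b≢c N₃) (Nbhd.b≢c N₄) , λ ()) ∷ [])
              ∷ (nonconflict⇒compatible ¬con₂₄ ∷ []) ∷ [] ∷ [])

        -- Girth at least five

        module _ (no-four-cycle : ∀ {x y a b} → x ≢ y → a ≢ b → Adj x a → Adj x b → Adj y a → Adj y b → ⊥) where

          -- `w` is the far end already fixed at another neighbor of `v`; only vertices not adjacent
          -- to it can be chosen next.
          Leaf : V → V → V → V → Set
          Leaf v w z x = Nbhd₂ z v x × ¬ Adj w x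

          leaf-adj : ∀ {v w z x} → Adj v z → Leaf v w z x → Adj z x
          leaf-adj vz ((_ , _ , N) , _) = adj-join vz (proj₂ (Nbhd.joinᵇ N))

          Leaves : V → V → V → Set
          Leaves v w z = ∃[ x ] ∃[ y ] x ≢ y × Leaf v w z x × Leaf v w z y

          -- Without 4-cycles, w is adjacent to at most one of the three leaves at z.
          two-leaves : ∀ {v w z} → Adj v z → w ≢ z → Leaves v w z
          two-leaves {v} {w} {z} vz w≢z with nbhd₁ (adj-sym vz)
          ... | p , q , r , N = [ (λ wp → [ (λ wq → ⊥-elim (twice N wp wq))
              , (λ w≁q → [ (λ wr → ⊥-elim (twice (swap₃₄ N) wp wr))
                         , (λ w≁r → take (swap₃₄ (swap₂₃ N)) w≁q w≁r) ]′ (decide (adj? w r))) ]′ (decide (adj? w q)))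
              , (λ w≁p → [ (λ wq → [ (λ wr → ⊥-elim (twice (swap₃₄ (swap₂₃ N)) wq wr))
                                   , (λ w≁r → take (swap₃₄ N) w≁p w≁r) ]′ (decide (adj? w r)))
                         , (λ w≁q → take N w≁p w≁q) ]′ (decide (adj? w q))) ]′ (decide (adj? w p))
            where
            twice : ∀ {p q r} → Nbhd z v p q r → Adj w p → ¬ Adj w q
            twice N wp wq = no-four-cycle w≢z (Nbhd.b≢c N) wp wq (adj-join vz (proj₂ (Nbhd.joinᵇ N))) (adj-join vz (proj₂ (Nbhd.joinᶜ N)))

            take : ∀ {p q r} → Nbhd z v p q r → ¬ Adj w p → ¬ Adj w q → Leaves v w z
            take N w≁p w≁q = _ , _ , Nbhd.b≢c N , ((_ , _ , N) , w≁p) , ((_ , _ , swap₂₃ N) , w≁q)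

          module _ {v w z₁ z₂ z₃ : V} (vz₁ : Adj v z₁) (vz₂ : Adj v z₂) (vz₃ : Adj v z₃) where

            Transversal : Set
            Transversal = ∃[ x ] ∃[ y ] ∃[ t ] Leaf v w z₁ x × Leaf v w z₂ y × Leaf v w z₃ t ×
              ¬ Adj x y × ¬ Adj x t × ¬ Adj y t

            -- Two links would make `x`, `y`, `z′`, `y′` a 4-cycle.
            one-link : ∀ {z z′ x y y′} → Adj v z → Adj v z′ → Leaf v w z x → Leaf v w z′ y → Leaf v w z′ y′ → y ≢ y′ →
              Adj x y → ¬ Adj x y′
            one-link {z} {z′} {x} vz vz′ lx ly ly′ y≢y′ xy xy′ =
              no-four-cycle x≢z′ y≢y′ xy xy′ (leaf-adj vz′ ly) (leaf-adj vz′ ly′)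
              where
              x≢z′ : x ≢ z′
              x≢z′ refl = no-triangle vz vz′ (leaf-adj vz lx)

            -- The links x–t and y–t′ are what blocks both transversals through x and y.
            crossed : ∀ {x x′ y y′ t t′} → Leaf v w z₁ x → Leaf v w z₁ x′ → Leaf v w z₂ y → Leaf v w z₂ y′ →
              Leaf v w z₃ t → Leaf v w z₃ t′ → x ≢ x′ → y ≢ y′ → t ≢ t′ → Adj x t → Adj y t′ → Transversal
            crossed lx lx′ ly ly′ lt lt′ x≢x′ y≢y′ t≢t′ xt yt′ with decide (adj? _ _)
            ... | inj₂ x′≁y = _ , _ , _ , lx′ , ly , lt , x′≁y ,
              one-link vz₃ vz₁ lt lx lx′ x≢x′ (adj-sym xt) ∘ adj-sym ,
              one-link vz₂ vz₃ ly lt′ lt (t≢t′ ∘ sym) yt′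
            ... | inj₁ x′y = _ , _ , _ , lx′ , ly′ , lt′ ,
              one-link vz₁ vz₂ lx′ ly ly′ y≢y′ x′y ,
              (λ x′t′ → no-triangle x′y x′t′ yt′) ,
              one-link vz₃ vz₂ lt′ ly ly′ y≢y′ (adj-sym yt′) ∘ adj-sym

            -- If neither `t` nor `t′` completes `x` and `y`, each of them is linked to `x` or to
            -- `y`. By `one-link` they are not both linked to the same one, so the links cross.
            from-nonadjacent : ∀ {x x′ y y′ t t′} → Leaf v w z₁ x → Leaf v w z₁ x′ → Leaf v w z₂ y → Leaf v w z₂ y′ →
              Leaf v w z₃ t → Leaf v w z₃ t′ → x ≢ x′ → y ≢ y′ → t ≢ t′ → ¬ Adj x y → Transversal
            from-nonadjacent {x} {x′} {y} {y′} {t} {t′} lx lx′ ly ly′ lt lt′ x≢x′ y≢y′ t≢t′ x≁y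
              with decide (adj? x t) | decide (adj? y t) | decide (adj? x t′) | decide (adj? y t′)
            ... | inj₂ x≁t | inj₂ y≁t | _ | _ = _ , _ , _ , lx , ly , lt , x≁y , x≁t , y≁t
            ... | _ | _ | inj₂ x≁t′ | inj₂ y≁t′ = _ , _ , _ , lx , ly , lt′ , x≁y , x≁t′ , y≁t′
            ... | inj₁ xt | _ | _ | inj₁ yt′ = crossed lx lx′ ly ly′ lt lt′ x≢x′ y≢y′ t≢t′ xt yt′
            ... | _ | inj₁ yt | inj₁ xt′ | _ = crossed lx lx′ ly ly′ lt′ lt x≢x′ y≢y′ (t≢t′ ∘ sym) xt′ yt
            ... | inj₁ xt | _ | inj₁ xt′ | _ = ⊥-elim (one-link vz₁ vz₃ lx lt lt′ t≢t′ xt xt′)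
            ... | _ | inj₁ yt | _ | inj₁ yt′ = ⊥-elim (one-link vz₂ vz₃ ly lt lt′ t≢t′ yt yt′)

            transversal : Leaves v w z₁ → Leaves v w z₂ → Leaves v w z₃ → Transversal
            transversal (x , x′ , x≢x′ , lx , lx′) (y , y′ , y≢y′ , ly , ly′) (t , t′ , t≢t′ , lt , lt′)
              with decide (adj? x y)
            ... | inj₂ x≁y = from-nonadjacent lx lx′ ly ly′ lt lt′ x≢x′ y≢y′ t≢t′ x≁y
            ... | inj₁ xy = from-nonadjacent lx lx′ ly′ ly lt lt′ x≢x′ (y≢y′ ∘ sym) t≢t′
              (one-link vz₁ vz₂ lx ly ly′ y≢y′ xy)

          -- Any further neighbor `w` of the first neighbor `a` will do. Each of the other three
          -- neighbors has two leaves not adjacent to `w`, and these six contain a transversal.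
          tree-case : ∀ {v} → v ∉ S → Planned
          tree-case {v} v∉ with nbhd v v∉
          ... | a , b , c , d , Nv with nbhd₁ (adj-sym (v∉ , Nbhd.joinᵃ Nv))
          ...   | w , s , t , Na with transversal {w = w} vb vc vd
                  (two-leaves vb (w≢ vb)) (two-leaves vc (w≢ vc)) (two-leaves vd (w≢ vd))
            where
            va : Adj v a
            va = v∉ , Nbhd.joinᵃ Nv
            vb : Adj v b
            vb = v∉ , Nbhd.joinᵇ Nv
            vc : Adj v c
            vc = v∉ , Nbhd.joinᶜ Nv
            vd : Adj v d
            vd = v∉ , Nbhd.joinᵈ Nv
            w≢ : ∀ {z} → Adj v z → w ≢ z
            w≢ vz refl = no-triangle va vz (adj-join va (proj₂ (Nbhd.joinᵇ Na)))
          ...     | x , y , z , ((_ , _ , Nb) , w≁x) , ((_ , _ , Nc) , w≁y) , ((_ , _ , Nd) , w≁z) , x≁y , x≁z , y≁z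
            with Nbhd.joinᵇ Na | Nbhd.joinᵇ Nb | Nbhd.joinᵇ Nc | Nbhd.joinᵇ Nd
          ...       | _ , jw | _ , jx | _ , jy | _ , jz =
            v , v∉ , _ , tree-plan Nv (_ , _ , Na) (_ , _ , Nb) (_ , _ , Nc) (_ , _ , Nd) jw jx jy jz
              ( (apart va vb a≢b Na Nb jw jx w≁x ∷ apart va vc a≢c Na Nc jw jy w≁y ∷ apart va vd a≢d Na Nd jw jz w≁z ∷ [])
              ∷ (apart vb vc b≢c Nb Nc jx jy x≁y ∷ apart vb vd b≢d Nb Nd jx jz x≁z ∷ [])
              ∷ (apart vc vd c≢d Nc Nd jy jz y≁z ∷ []) ∷ [] ∷ [])
            where
            open Nbhd Nv
            va : Adj v a
            va = v∉ , joinᵃ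
            vb : Adj v b
            vb = v∉ , joinᵇ
            vc : Adj v c
            vc = v∉ , joinᶜ
            vd : Adj v d
            vd = v∉ , joinᵈ

            apart : ∀ {p q x y f g s t s′ t′} → Adj v p → Adj v q → p ≢ q → Nbhd p v x s t → Nbhd q v y s′ t′ →
              Join f p x → Join g q y → ¬ Adj x y → ¬ Conflict G f g
            apart vp vq p≢q Np Nq jf jg = nonconflicting vp vq p≢q jf jg
              (λ qx → no-four-cycle (Nbhd.a≢b Np) p≢q vp vq (adj-sym (adj-join vp jf)) (adj-sym qx))
              (λ py → no-four-cycle (Nbhd.a≢b Nq) p≢q vp vq (adj-sym py) (adj-sym (adj-join vq jg)))

      -- Each failed search supplies the hypothesis under which the later cases are treated.
      regular-case : ∀ {v} → v ∉ S → Planned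
      regular-case v∉ with any? (λ x → any? λ y → any? λ z → adj? x y ×-dec adj? x z ×-dec adj? y z)
      ... | yes (_ , _ , _ , xy , xz , yz) = triangle-case xy xz yz
      ... | no ¬tri with any? (λ v → any? λ u → any? λ a → any? λ b → any? λ c →
              ¬? (v ≟ u) ×-dec (adj? v a ×-dec adj? v b ×-dec adj? v c) ×-dec (adj? u a ×-dec adj? u b ×-dec adj? u c)
              ×-dec ¬? (a ≟ b) ×-dec ¬? (a ≟ c) ×-dec ¬? (b ≟ c))
      ...   | yes (_ , _ , _ , _ , _ , v≢u , (va , vb , vc) , (ua , ub , uc) , a≢b , a≢c , b≢c) =
        theta-case no-triangle v≢u va vb vc ua ub uc a≢b a≢c b≢c
        where
        no-triangle : ∀ {x y z} → Adj x y → Adj x z → ¬ Adj y z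
        no-triangle xy xz yz = ¬tri (_ , _ , _ , xy , xz , yz)
      ...   | no ¬theta with any? (λ x → any? λ y → any? λ a → any? λ b →
              ¬? (x ≟ y) ×-dec ¬? (a ≟ b) ×-dec adj? x a ×-dec adj? x b ×-dec adj? y a ×-dec adj? y b)
      ...     | yes (_ , _ , _ , _ , x≢y , a≢b , xa , xb , ya , yb) =
        four-cycle-case (λ xy xz yz → ¬tri (_ , _ , _ , xy , xz , yz))
          (λ v≢u va vb vc ua ub uc a≢b a≢c b≢c →
            ¬theta (_ , _ , _ , _ , _ , v≢u , (va , vb , vc) , (ua , ub , uc) , a≢b , a≢c , b≢c))
          x≢y a≢b xa xb ya yb
      ...     | no ¬cycle =
        tree-case (λ xy xz yz → ¬tri (_ , _ , _ , xy , xz , yz))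
          (λ x≢y a≢b xa xb ya yb → ¬cycle (_ , _ , _ , _ , x≢y , a≢b , xa , xb , ya , yb)) v∉

    -- All other configurations presuppose four simple edges at every vertex outside `S`, so a
    -- deficient vertex found anywhere there takes precedence over `v`.
    planned : ∀ {v} → v ∉ S → Planned
    planned v∉ with search {P = λ x → x ∉ S × Deficient x} {Q = λ x → x ∉ S → ∃[ a ] Nbhd₁ x a} classify
      where
      classify : ∀ x → (x ∉ S × Deficient x) ⊎ (x ∉ S → ∃[ a ] Nbhd₁ x a)
      classify x with decide (_∈?_ _≟_ x S) | deficient-or-nbhd x
      ... | inj₁ x∈ | _ = inj₂ λ x∉ → contradiction x∈ x∉
      ... | inj₂ x∉ | inj₁ def = inj₁ (x∉ , def)
      ... | inj₂ _ | inj₂ N = inj₂ λ _ → N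
    ... | inj₁ (w , w∉ , def) = w , w∉ , [] , deficient-plan def
    ... | inj₂ nbhd = regular-case nbhd v∉

theorem2 : (G : Graph) → MaxDegree G 4 →
    Σ (Fin (m G) → Fin 22) (IsStrongEdgeColoring G 22)
theorem2 G (degree≤4 , _) = strong-coloring G degree≤4 λ closed → Choice.planned G degree≤4 closed
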